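{- Let $n,s$ be positive integers such that $n\ge 3s+3$. Let $H$ be a $3$-graph with vertex set $[n]$. If for every $v\in V(H)$, \[ \rho(N_H(v))>\frac{1}{2}\Big(s-1+\sqrt{(s-1)^2+4s(n-s-1)}\Big), \] then $H$ has a fractional matching of size $s+1$. Moreover, if $n=3s+3$ and $\rho(N_H(v))>2n/3-2$ for every $v\in V(H)$, then $H$ has a perfect fractional matching.
   Context: $[n]=\{1,\dots,n\}$. A $3$-graph $H$ is a $3$-uniform hypergraph: a vertex set $V(H)$ together with an edge set $E(H)\subseteq\binom{V(H)}{3}$, the family of $3$-element subsets of $V(H)$. For $v\in V(H)$, the link graph $N_H(v)$ is the simple graph with vertex set $V(H)\setminus\{v\}$ and edge set $\{e\subseteq V(H)\setminus\{v\}: e\cup\{v\}\in E(H)\}$ (its edges are $2$-sets). For a simple graph $G$, $\rho(G)$ denotes its spectral radius, i.e. the largest eigenvalue of its adjacency matrix. A fractional matching in $H$ is a function $f:E(H)\to[0,1]$ such that $\sum_{e\ni v}f(e)\le 1$ for every $v\in V(H)$; its size is $\sum_{e\in E(H)}f(e)$. It is a perfect fractional matching if $\sum_{e\ni v}f(e)=1$ for every $v\in V(H)$. -}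

module Defs where

open import Data.Bool.Base using (Bool; true; false; if_then_else_; T)
open import Data.Fin.Base using (Fin; zero; suc)
open import Data.Fin.Subset using (Subset; ∣_∣; ⁅_⁆; _∪_; inside; outside)
open import Data.Integer.Base as ℤ using (+_)
import Data.Integer.Properties as ℤₚ
open import Data.List.Base as List using (List; []; _∷_; _++_; filterᵇ)
open import Data.Nat.Base as ℕ using (ℕ; zero; suc; pred)
import Data.Nat.Properties as ℕₚ
open import Data.Nat.Tactic.RingSolver using (solve-∀)
open import Data.Product.Base using (∃; _×_; _,_; proj₁; proj₂)
open import Data.Rational.Base as ℚ using (ℚ; 0ℚ; 1ℚ; ½; mkℚ)
import Data.Rational.Properties as ℚₚ
open import Data.Rational.Solver using (module +-*-Solver)
import Data.Rational.Unnormalised.Base as ℚᵘ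
import Data.Rational.Unnormalised.Properties as ℚᵘₚ
open import Data.Sum.Base using (_⊎_; inj₁; inj₂)
open import Data.Vec.Base as Vec using ([]; _∷_; lookup; insertAt)
import Data.Vec.Functional as Vector
open import Relation.Binary.PropositionalEquality
  using (_≡_; refl; sym; trans; cong; cong₂; subst)
open import Relation.Nullary using (¬_; yes; no)

------------------------------------------------------------------------
-- Real numbers: Cauchy sequences of rationals with a modulus, compared
-- by the setoid equality _≃_.

IsCauchy : (ℕ → ℚ) → Set
IsCauchy x = ∀ ε → 0ℚ ℚ.< ε →
  ∃ λ N → ∀ m n → N ℕ.≤ m → N ℕ.≤ n → ℚ.∣ x m ℚ.- x n ∣ ℚ.≤ ε

record ℝ : Set where
  constructor mkℝ
  field
    seq    : ℕ → ℚ
    cauchy : IsCauchy seq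

open ℝ public

infix 4 _≃_ _<ℝ_ _≤ℝ_ _#_

_≃_ : ℝ → ℝ → Set
x ≃ y = ∀ ε → 0ℚ ℚ.< ε →
  ∃ λ N → ∀ n → N ℕ.≤ n → ℚ.∣ seq x n ℚ.- seq y n ∣ ℚ.≤ ε

_<ℝ_ : ℝ → ℝ → Set
x <ℝ y = ∃ λ ε → 0ℚ ℚ.< ε ×
  ∃ λ N → ∀ n → N ℕ.≤ n → seq x n ℚ.+ ε ℚ.≤ seq y n

_≤ℝ_ : ℝ → ℝ → Set
x ≤ℝ y = ¬ (y <ℝ x)

-- Apartness: the constructive reading of "x ≠ y".
_#_ : ℝ → ℝ → Set
x # y = x <ℝ y ⊎ y <ℝ x

fromℚ : ℚ → ℝ
fromℚ q = mkℝ (λ _ → q) λ ε 0<ε → 0 , λ _ _ _ _ →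
  subst (λ r → ℚ.∣ r ∣ ℚ.≤ ε) (sym (ℚₚ.+-inverseʳ q)) (ℚₚ.<⇒≤ 0<ε)

fromℕ : ℕ → ℝ
fromℕ m = fromℚ (+ m ℚ./ 1)

0ℝ 1ℝ : ℝ
0ℝ = fromℕ 0
1ℝ = fromℕ 1

private
  halve : ∀ ε → 0ℚ ℚ.< ε → 0ℚ ℚ.< ½ ℚ.* ε
  halve ε 0<ε = ℚₚ.*-monoʳ-<-pos ½ 0<ε

  half+half : ∀ ε → ½ ℚ.* ε ℚ.+ ½ ℚ.* ε ≡ ε
  half+half ε = trans (sym (ℚₚ.*-distribʳ-+ ε ½ ½)) (ℚₚ.*-identityˡ ε)

  +-cauchy : ∀ x y → IsCauchy x → IsCauchy y → IsCauchy (λ n → x n ℚ.+ y n)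
  +-cauchy x y cx cy ε 0<ε = N₁ ℕ.⊔ N₂ , bound
    where
    N₁ = proj₁ (cx (½ ℚ.* ε) (halve ε 0<ε))
    N₂ = proj₁ (cy (½ ℚ.* ε) (halve ε 0<ε))
    open ℚₚ.≤-Reasoning
    bound : ∀ m n → N₁ ℕ.⊔ N₂ ℕ.≤ m → N₁ ℕ.⊔ N₂ ℕ.≤ n →
            ℚ.∣ (x m ℚ.+ y m) ℚ.- (x n ℚ.+ y n) ∣ ℚ.≤ ε
    bound m n N≤m N≤n = begin
      ℚ.∣ (x m ℚ.+ y m) ℚ.- (x n ℚ.+ y n) ∣
        ≡⟨ cong ℚ.∣_∣ (+-*-Solver.solve 4
             (λ a b c d → ((a :+ b) :- (c :+ d)) := ((a :- c) :+ (b :- d)))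
             refl (x m) (y m) (x n) (y n)) ⟩
      ℚ.∣ (x m ℚ.- x n) ℚ.+ (y m ℚ.- y n) ∣
        ≤⟨ ℚₚ.∣p+q∣≤∣p∣+∣q∣ (x m ℚ.- x n) (y m ℚ.- y n) ⟩
      ℚ.∣ x m ℚ.- x n ∣ ℚ.+ ℚ.∣ y m ℚ.- y n ∣
        ≤⟨ ℚₚ.+-mono-≤
             (proj₂ (cx (½ ℚ.* ε) (halve ε 0<ε)) m n (ℕₚ.m⊔n≤o⇒m≤o N₁ N₂ N≤m) (ℕₚ.m⊔n≤o⇒m≤o N₁ N₂ N≤n))
             (proj₂ (cy (½ ℚ.* ε) (halve ε 0<ε)) m n (ℕₚ.m⊔n≤o⇒n≤o N₁ N₂ N≤m) (ℕₚ.m⊔n≤o⇒n≤o N₁ N₂ N≤n)) ⟩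
      ½ ℚ.* ε ℚ.+ ½ ℚ.* ε
        ≡⟨ half+half ε ⟩
      ε ∎
      where open +-*-Solver using (_:+_; _:-_; _:=_)

  0<1 : 0ℚ ℚ.< 1ℚ
  0<1 = ℚₚ.positive⁻¹ 1ℚ

  module Bounded (x : ℕ → ℚ) (cx : IsCauchy x) where
    from : ℕ
    from = proj₁ (cx 1ℚ 0<1)

    B : ℚ
    B = 1ℚ ℚ.+ ℚ.∣ x from ∣

    B-pos : ℚ.Positive B
    B-pos = ℚₚ.pos+nonNeg⇒pos 1ℚ ℚ.∣ x from ∣ {{ℚₚ.∣-∣-nonNeg (x from)}}

    bounded : ∀ n → from ℕ.≤ n → ℚ.∣ x n ∣ ℚ.≤ B
    bounded n N≤n = begin
      ℚ.∣ x n ∣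
        ≡⟨ cong ℚ.∣_∣ (+-*-Solver.solve 2 (λ a b → a := ((a :- b) :+ b)) refl (x n) (x from)) ⟩
      ℚ.∣ (x n ℚ.- x from) ℚ.+ x from ∣
        ≤⟨ ℚₚ.∣p+q∣≤∣p∣+∣q∣ (x n ℚ.- x from) (x from) ⟩
      ℚ.∣ x n ℚ.- x from ∣ ℚ.+ ℚ.∣ x from ∣
        ≤⟨ ℚₚ.+-monoˡ-≤ ℚ.∣ x from ∣ (proj₂ (cx 1ℚ 0<1) n from N≤n ℕₚ.≤-refl) ⟩
      B ∎
      where
      open ℚₚ.≤-Reasoning
      open +-*-Solver using (_:+_; _:-_; _:=_)

  *-cauchy : ∀ x y → IsCauchy x → IsCauchy y → IsCauchy (λ n → x n ℚ.* y n)
  *-cauchy x y cx cy ε 0<ε = N , bound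
    where
    module X = Bounded x cx
    module Y = Bounded y cy
    K = X.B ℚ.+ Y.B
    instance
      K-pos : ℚ.Positive K
      K-pos = ℚₚ.pos+pos⇒pos X.B {{X.B-pos}} Y.B {{Y.B-pos}}
      K-nz : ℚ.NonZero K
      K-nz = ℚₚ.pos⇒nonZero K
      1/K-pos : ℚ.Positive (ℚ.1/ K)
      1/K-pos = ℚₚ.1/pos⇒pos K
    δ = ε ℚ.* ℚ.1/ K
    0<δ : 0ℚ ℚ.< δ
    0<δ = subst (ℚ._< δ) (ℚₚ.*-zeroˡ (ℚ.1/ K)) (ℚₚ.*-monoˡ-<-pos (ℚ.1/ K) 0<ε)
    N₁ = proj₁ (cx δ 0<δ)
    N₂ = proj₁ (cy δ 0<δ)
    N₃ = X.from ℕ.⊔ Y.from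
    N = (N₁ ℕ.⊔ N₂) ℕ.⊔ N₃
    mul-≤ : ∀ {p q b d} → 0ℚ ℚ.≤ p → 0ℚ ℚ.≤ d → p ℚ.≤ b → q ℚ.≤ d →
            p ℚ.* q ℚ.≤ b ℚ.* d
    mul-≤ {p} {q} {b} {d} 0≤p 0≤d p≤b q≤d = ℚₚ.≤-trans
      (ℚₚ.*-monoˡ-≤-nonNeg p {{ℚ.nonNegative 0≤p}} q≤d)
      (ℚₚ.*-monoʳ-≤-nonNeg d {{ℚ.nonNegative 0≤d}} p≤b)
    open ℚₚ.≤-Reasoning
    bound : ∀ m n → N ℕ.≤ m → N ℕ.≤ n → ℚ.∣ x m ℚ.* y m ℚ.- x n ℚ.* y n ∣ ℚ.≤ ε
    bound m n N≤m N≤n = begin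
      ℚ.∣ x m ℚ.* y m ℚ.- x n ℚ.* y n ∣
        ≡⟨ cong ℚ.∣_∣ (+-*-Solver.solve 4
             (λ a b c d → (a :* b :- c :* d) := (a :* (b :- d) :+ d :* (a :- c)))
             refl (x m) (y m) (x n) (y n)) ⟩
      ℚ.∣ x m ℚ.* (y m ℚ.- y n) ℚ.+ y n ℚ.* (x m ℚ.- x n) ∣
        ≤⟨ ℚₚ.∣p+q∣≤∣p∣+∣q∣ (x m ℚ.* (y m ℚ.- y n)) (y n ℚ.* (x m ℚ.- x n)) ⟩
      ℚ.∣ x m ℚ.* (y m ℚ.- y n) ∣ ℚ.+ ℚ.∣ y n ℚ.* (x m ℚ.- x n) ∣
        ≡⟨ cong₂ ℚ._+_ (ℚₚ.∣p*q∣≡∣p∣*∣q∣ (x m) (y m ℚ.- y n)) (ℚₚ.∣p*q∣≡∣p∣*∣q∣ (y n) (x m ℚ.- x n)) ⟩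
      ℚ.∣ x m ∣ ℚ.* ℚ.∣ y m ℚ.- y n ∣ ℚ.+ ℚ.∣ y n ∣ ℚ.* ℚ.∣ x m ℚ.- x n ∣
        ≤⟨ ℚₚ.+-mono-≤
             (mul-≤ (ℚₚ.0≤∣p∣ (x m)) (ℚₚ.<⇒≤ 0<δ)
               (X.bounded m (ℕₚ.m⊔n≤o⇒m≤o X.from Y.from (N₃≤ N≤m)))
               (proj₂ (cy δ 0<δ) m n (N₂≤ N≤m) (N₂≤ N≤n)))
             (mul-≤ (ℚₚ.0≤∣p∣ (y n)) (ℚₚ.<⇒≤ 0<δ)
               (Y.bounded n (ℕₚ.m⊔n≤o⇒n≤o X.from Y.from (N₃≤ N≤n)))
               (proj₂ (cx δ 0<δ) m n (N₁≤ N≤m) (N₁≤ N≤n))) ⟩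
      X.B ℚ.* δ ℚ.+ Y.B ℚ.* δ
        ≡⟨ sym (ℚₚ.*-distribʳ-+ δ X.B Y.B) ⟩
      K ℚ.* (ε ℚ.* ℚ.1/ K)
        ≡⟨ ℚₚ.*-comm K δ ⟩
      ε ℚ.* ℚ.1/ K ℚ.* K
        ≡⟨ ℚₚ.*-assoc ε (ℚ.1/ K) K ⟩
      ε ℚ.* (ℚ.1/ K ℚ.* K)
        ≡⟨ cong (ε ℚ.*_) (ℚₚ.*-inverseˡ K) ⟩
      ε ℚ.* 1ℚ
        ≡⟨ ℚₚ.*-identityʳ ε ⟩
      ε ∎
      where
      open +-*-Solver using (_:+_; _:-_; _:*_; _:=_)
      N₁≤ : ∀ {k} → N ℕ.≤ k → N₁ ℕ.≤ k
      N₁≤ h = ℕₚ.m⊔n≤o⇒m≤o N₁ N₂ (ℕₚ.m⊔n≤o⇒m≤o (N₁ ℕ.⊔ N₂) N₃ h)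
      N₂≤ : ∀ {k} → N ℕ.≤ k → N₂ ℕ.≤ k
      N₂≤ h = ℕₚ.m⊔n≤o⇒n≤o N₁ N₂ (ℕₚ.m⊔n≤o⇒m≤o (N₁ ℕ.⊔ N₂) N₃ h)
      N₃≤ : ∀ {k} → N ℕ.≤ k → N₃ ℕ.≤ k
      N₃≤ h = ℕₚ.m⊔n≤o⇒n≤o (N₁ ℕ.⊔ N₂) N₃ h

infixl 6 _+ℝ_
infixl 7 _*ℝ_

_+ℝ_ _*ℝ_ : ℝ → ℝ → ℝ
x +ℝ y = mkℝ (λ n → seq x n ℚ.+ seq y n) (+-cauchy (seq x) (seq y) (cauchy x) (cauchy y))
x *ℝ y = mkℝ (λ n → seq x n ℚ.* seq y n) (*-cauchy (seq x) (seq y) (cauchy x) (cauchy y))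

sumList : {A : Set} → (A → ℝ) → List A → ℝ
sumList f xs = List.foldr _+ℝ_ 0ℝ (List.map f xs)

sumFin : ∀ {n} → (Fin n → ℝ) → ℝ
sumFin = Vector.foldr _+ℝ_ 0ℝ

⌊√_⌋ : ℕ → ℕ
⌊√ zero ⌋  = zero
⌊√ suc m ⌋ with suc ⌊√ m ⌋ ℕ.* suc ⌊√ m ⌋ ℕₚ.≤? suc m
... | yes _ = suc ⌊√ m ⌋
... | no  _ = ⌊√ m ⌋

⌊√⌋-lower : ∀ m → ⌊√ m ⌋ ℕ.* ⌊√ m ⌋ ℕ.≤ m
⌊√⌋-lower zero = ℕ.z≤n
⌊√⌋-lower (suc m) with suc ⌊√ m ⌋ ℕ.* suc ⌊√ m ⌋ ℕₚ.≤? suc m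
... | yes h = h
... | no  _ = ℕₚ.m≤n⇒m≤1+n (⌊√⌋-lower m)

⌊√⌋-upper : ∀ m → m ℕ.< suc ⌊√ m ⌋ ℕ.* suc ⌊√ m ⌋
⌊√⌋-upper zero = ℕ.s≤s ℕ.z≤n
⌊√⌋-upper (suc m) with suc ⌊√ m ⌋ ℕ.* suc ⌊√ m ⌋ ℕₚ.≤? suc m
... | yes _ = ℕₚ.≤-<-trans (⌊√⌋-upper m)
                (ℕₚ.*-mono-< (ℕₚ.n<1+n (suc ⌊√ m ⌋)) (ℕₚ.n<1+n (suc ⌊√ m ⌋)))
... | no ¬h = ℕₚ.≰⇒> ¬h

-- The real √m as the limit of ⌊(k+1)√m⌋ / (k+1).

√-numerator : ℕ → ℕ → ℕ
√-numerator m k = ⌊√ m ℕ.* (suc k ℕ.* suc k) ⌋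

√-seq : ℕ → ℕ → ℚ
√-seq m k = + √-numerator m k ℚ./ suc k

private
  sq-cancel-< : ∀ {a b} → a ℕ.* a ℕ.< b ℕ.* b → a ℕ.< b
  sq-cancel-< {a} {b} h with a ℕₚ.<? b
  ... | yes p = p
  ... | no ¬p with () ← ℕₚ.<⇒≱ h (ℕₚ.*-mono-≤ (ℕₚ.≮⇒≥ ¬p) (ℕₚ.≮⇒≥ ¬p))

  √-cross : ∀ m k l → √-numerator m k ℕ.* suc l ℕ.< suc (√-numerator m l) ℕ.* suc k
  √-cross m k l = sq-cancel-< (begin-strict
    (a ℕ.* suc l) ℕ.* (a ℕ.* suc l)
      ≡⟨ square a (suc l) ⟩
    (a ℕ.* a) ℕ.* (suc l ℕ.* suc l)
      ≤⟨ ℕₚ.*-monoˡ-≤ (suc l ℕ.* suc l) (⌊√⌋-lower (m ℕ.* (suc k ℕ.* suc k))) ⟩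
    m ℕ.* (suc k ℕ.* suc k) ℕ.* (suc l ℕ.* suc l)
      ≡⟨ swap m (suc k ℕ.* suc k) (suc l ℕ.* suc l) ⟩
    m ℕ.* (suc l ℕ.* suc l) ℕ.* (suc k ℕ.* suc k)
      <⟨ ℕₚ.*-monoˡ-< (suc k ℕ.* suc k) (⌊√⌋-upper (m ℕ.* (suc l ℕ.* suc l))) ⟩
    (suc b ℕ.* suc b) ℕ.* (suc k ℕ.* suc k)
      ≡⟨ sym (square (suc b) (suc k)) ⟩
    (suc b ℕ.* suc k) ℕ.* (suc b ℕ.* suc k) ∎)
    where
    open ℕₚ.≤-Reasoning
    a = √-numerator m k
    b = √-numerator m l
    square : ∀ p q → (p ℕ.* q) ℕ.* (p ℕ.* q) ≡ (p ℕ.* p) ℕ.* (q ℕ.* q)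
    square = solve-∀
    swap : ∀ p q r → p ℕ.* q ℕ.* r ≡ p ℕ.* r ℕ.* q
    swap = solve-∀

  /-mono : ∀ a b k l → a ℕ.* suc l ℕ.≤ b ℕ.* suc k → + a ℚ./ suc k ℚ.≤ + b ℚ./ suc l
  /-mono a b k l h = ℚₚ.toℚᵘ-cancel-≤ (begin
    ℚ.toℚᵘ (+ a ℚ./ suc k)   ≃⟨ ℚₚ.toℚᵘ-fromℚᵘ (ℚᵘ.mkℚᵘ (+ a) k) ⟩
    ℚᵘ.mkℚᵘ (+ a) k          ≤⟨ ℚᵘ.*≤* (begin′ h) ⟩
    ℚᵘ.mkℚᵘ (+ b) l          ≃⟨ ℚᵘₚ.≃-sym (ℚₚ.toℚᵘ-fromℚᵘ (ℚᵘ.mkℚᵘ (+ b) l)) ⟩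
    ℚ.toℚᵘ (+ b ℚ./ suc l)   ∎)
    where
    open ℚᵘₚ.≤-Reasoning
    begin′ : a ℕ.* suc l ℕ.≤ b ℕ.* suc k → (+ a) ℤ.* (+ suc l) ℤ.≤ (+ b) ℤ.* (+ suc k)
    begin′ h rewrite sym (ℤₚ.pos-* a (suc l)) | sym (ℤₚ.pos-* b (suc k)) = ℤ.+≤+ h

  /-suc : ∀ b l → + suc b ℚ./ suc l ≡ + b ℚ./ suc l ℚ.+ + 1 ℚ./ suc l
  /-suc b l = ℚₚ.toℚᵘ-injective (begin
    ℚ.toℚᵘ (+ suc b ℚ./ suc l)
      ≈⟨ ℚₚ.toℚᵘ-fromℚᵘ (ℚᵘ.mkℚᵘ (+ suc b) l) ⟩
    ℚᵘ.mkℚᵘ (+ suc b) l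
      ≈⟨ ℚᵘ.*≡* (eq b l) ⟩
    ℚᵘ.mkℚᵘ (+ b) l ℚᵘ.+ ℚᵘ.mkℚᵘ (+ 1) l
      ≈⟨ ℚᵘₚ.+-cong (ℚₚ.toℚᵘ-fromℚᵘ (ℚᵘ.mkℚᵘ (+ b) l)) (ℚₚ.toℚᵘ-fromℚᵘ (ℚᵘ.mkℚᵘ (+ 1) l)) ⟨
    ℚ.toℚᵘ (+ b ℚ./ suc l) ℚᵘ.+ ℚ.toℚᵘ (+ 1 ℚ./ suc l)
      ≈⟨ ℚₚ.toℚᵘ-homo-+ (+ b ℚ./ suc l) (+ 1 ℚ./ suc l) ⟨
    ℚ.toℚᵘ (+ b ℚ./ suc l ℚ.+ + 1 ℚ./ suc l) ∎)
    where
    open import Relation.Binary.Reasoning.Setoid ℚᵘₚ.≃-setoid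
    nat : ∀ b l → suc b ℕ.* (suc l ℕ.* suc l) ≡ (b ℕ.* suc l ℕ.+ 1 ℕ.* suc l) ℕ.* suc l
    nat = solve-∀
    eq : ∀ b l → (+ suc b) ℤ.* (+ (suc l ℕ.* suc l)) ≡
         ((+ b) ℤ.* (+ suc l) ℤ.+ (+ 1) ℤ.* (+ suc l)) ℤ.* (+ suc l)
    eq b l rewrite sym (ℤₚ.pos-* b (suc l)) =
      trans (cong +_ (nat b l)) (ℤₚ.pos-* (b ℕ.* suc l ℕ.+ 1 ℕ.* suc l) (suc l))

  √-step : ∀ m k l → √-seq m k ℚ.≤ √-seq m l ℚ.+ + 1 ℚ./ suc l
  √-step m k l = subst (√-seq m k ℚ.≤_) (/-suc (√-numerator m l) l)
    (/-mono (√-numerator m k) (suc (√-numerator m l)) k l (ℕₚ.<⇒≤ (√-cross m k l)))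

  archimedean : ∀ ε → 0ℚ ℚ.< ε → ∀ l → ℚ.↧ₙ ε ℕ.≤ l → + 1 ℚ./ suc l ℚ.≤ ε
  archimedean ε@(mkℚ (+ zero) d c) 0<ε l d≤l
    with () ← ℚ.positive 0<ε
  archimedean ε@(mkℚ ℤ.-[1+ a ] d c) 0<ε l d≤l
    with () ← ℚ.positive 0<ε
  archimedean ε@(mkℚ (+ suc a) d c) 0<ε l d≤l =
    subst (+ 1 ℚ./ suc l ℚ.≤_) (ℚₚ.↥p/↧p≡p ε)
      (/-mono 1 (suc a) l d (ℕₚ.≤-trans
        (ℕₚ.≤-reflexive (ℕₚ.*-identityˡ (suc d)))
        (ℕₚ.≤-trans (ℕₚ.m≤n⇒m≤1+n d≤l) (ℕₚ.m≤m+n (suc l) (a ℕ.* suc l)))))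

  ∣-∣-≤ : ∀ p q ε → p ℚ.≤ q ℚ.+ ε → q ℚ.≤ p ℚ.+ ε → ℚ.∣ p ℚ.- q ∣ ℚ.≤ ε
  ∣-∣-≤ p q ε p≤ q≤ with ℚₚ.∣p∣≡p∨∣p∣≡-p (p ℚ.- q)
  ... | inj₁ e = subst (ℚ._≤ ε) (sym e)
        (subst (p ℚ.- q ℚ.≤_) (+-*-Solver.solve 2 (λ q ε → (q :+ ε) :- q := ε) refl q ε)
          (ℚₚ.+-monoˡ-≤ (ℚ.- q) p≤))
    where open +-*-Solver using (_:+_; _:-_; _:=_)
  ... | inj₂ e = subst (ℚ._≤ ε) (sym (trans e (+-*-Solver.solve 2 (λ p q → :- (p :- q) := q :- p) refl p q)))
        (subst (q ℚ.- p ℚ.≤_) (+-*-Solver.solve 2 (λ p ε → (p :+ ε) :- p := ε) refl p ε)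
          (ℚₚ.+-monoˡ-≤ (ℚ.- p) q≤))
    where open +-*-Solver using (_:+_; _:-_; :-_; _:=_)

√_ : ℕ → ℝ
√ m = mkℝ (√-seq m) λ ε 0<ε → ℚ.↧ₙ ε , λ k l N≤k N≤l →
  ∣-∣-≤ (√-seq m k) (√-seq m l) ε
    (ℚₚ.≤-trans (√-step m k l) (ℚₚ.+-monoʳ-≤ (√-seq m l) (archimedean ε 0<ε l N≤l)))
    (ℚₚ.≤-trans (√-step m l k) (ℚₚ.+-monoʳ-≤ (√-seq m k) (archimedean ε 0<ε k N≤k)))

------------------------------------------------------------------------
-- r-uniform hypergraphs on the vertex set Fin n; r = 2 gives simple
-- graphs.

record UniformHypergraph (r n : ℕ) : Set where
  field
    isEdge  : Subset n → Bool
    uniform : ∀ e → T (isEdge e) → ∣ e ∣ ≡ r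

open UniformHypergraph public

SimpleGraph : ℕ → Set
SimpleGraph = UniformHypergraph 2

3-Graph : ℕ → Set
3-Graph = UniformHypergraph 3

subsets : ∀ n → List (Subset n)
subsets zero    = [] ∷ []
subsets (suc n) = List.map (outside ∷_) (subsets n) ++ List.map (inside ∷_) (subsets n)

edges : ∀ {r n} → UniformHypergraph r n → List (Subset n)
edges {n = n} H = filterᵇ (isEdge H) (subsets n)

edgesAt : ∀ {r n} → UniformHypergraph r n → Fin n → List (Subset n)
edgesAt H v = filterᵇ (λ e → lookup e v) (edges H)

private
  ∣insertAt∣ : ∀ {n} (e : Subset n) v → ∣ insertAt e v inside ∣ ≡ suc ∣ e ∣
  ∣insertAt∣ e             zero    = refl
  ∣insertAt∣ (inside ∷ e)  (suc v) = cong suc (∣insertAt∣ e v)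
  ∣insertAt∣ (outside ∷ e) (suc v) = ∣insertAt∣ e v

-- The vertices other than v are identified with Fin (pred n) by
-- punchIn v, under which insertAt e v inside is e ∪ {v}.
link : ∀ {r n} → UniformHypergraph (suc r) n → Fin n → UniformHypergraph r (pred n)
link {n = suc _} H v = record
  { isEdge  = λ e → isEdge H (insertAt e v inside)
  ; uniform = λ e h → ℕₚ.suc-injective
      (trans (sym (∣insertAt∣ e v)) (uniform H (insertAt e v inside) h))
  }

------------------------------------------------------------------------
-- Spectral radius

-- For i = j the set is a singleton, hence not an edge, and the entry is 0.
adjacencyMatrix : ∀ {n} → SimpleGraph n → Fin n → Fin n → ℝ
adjacencyMatrix G i j = if isEdge G (⁅ i ⁆ ∪ ⁅ j ⁆) then 1ℝ else 0ℝ

IsEigenvalue : ∀ {n} → (Fin n → Fin n → ℝ) → ℝ → Set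
IsEigenvalue {n} A μ = ∃ λ (x : Fin n → ℝ) →
  (∃ λ i → x i # 0ℝ) × (∀ i → sumFin (λ j → A i j *ℝ x j) ≃ μ *ℝ x i)

IsSpectralRadius : ∀ {n} → SimpleGraph n → ℝ → Set
IsSpectralRadius G ρ =
  IsEigenvalue (adjacencyMatrix G) ρ ×
  (∀ μ → IsEigenvalue (adjacencyMatrix G) μ → μ ≤ℝ ρ)

------------------------------------------------------------------------
-- Fractional matchings

-- Only the restriction of f to E(H) matters: values on other subsets are
-- unconstrained and never summed.
IsFractionalMatching : ∀ {r n} → UniformHypergraph r n → (Subset n → ℝ) → Set
IsFractionalMatching H f =
  (∀ e → T (isEdge H e) → 0ℝ ≤ℝ f e × f e ≤ℝ 1ℝ) ×
  (∀ v → sumList f (edgesAt H v) ≤ℝ 1ℝ)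

size : ∀ {r n} → UniformHypergraph r n → (Subset n → ℝ) → ℝ
size H f = sumList f (edges H)

HasFractionalMatchingOfSize : ∀ {r n} → UniformHypergraph r n → ℝ → Set
HasFractionalMatchingOfSize H c =
  ∃ λ f → IsFractionalMatching H f × size H f ≃ c

HasPerfectFractionalMatching : ∀ {r n} → UniformHypergraph r n → Set
HasPerfectFractionalMatching H =
  ∃ λ f → IsFractionalMatching H f × (∀ v → sumList f (edgesAt H v) ≃ 1ℝ)

{-# OPTIONS --safe #-}

-- If H has no fractional matching of size s + 1, linear programming duality
-- gives a fractional vertex cover of total weight below s + 1. Since
-- n ≥ 3 s + 3, the minimal weight can be subtracted everywhere (and the cover
-- rescaled), so the link of a vertex v of minimal weight has a fractional
-- vertex cover of weight below s + 1. Rounding it to the values 1, 1/2, 0 splits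
-- the link into layers of sizes a, b, c with 2 a + b ≤ 2 s + 1, every edge
-- meeting the first layer or lying inside the second. A positive vector y,
-- constant on the layers, then satisfies A y ≤ θ y for every rational
-- θ ≥ ½ (s - 1 + √((s - 1)² + 4 s (n - s - 1))), and pairing y with the absolute
-- value of an eigenvector bounds ρ(N_H(v)) by θ. When n = 3 s + 3 the threshold
-- is 2 s = 2 n / 3 - 2, and a fractional matching of size n / 3 is perfect.

module Submission where

open import Defs
open import Algebra.Bundles using (CommutativeRing)
import Algebra.Properties.CommutativeMonoid.Sum as MonoidSum
import Algebra.Properties.Semiring.Sum as SemiringSum
open import Data.Bool.Base using (Bool; true; false; if_then_else_; T; _∨_)
open import Data.Bool.Properties using (T?) renaming (_≟_ to _≟ᵇ_)
open import Data.Empty using (⊥; ⊥-elim)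
open import Data.Fin.Base using (Fin; zero; suc; punchIn)
import Data.Fin.Properties as Finₚ
open import Data.Fin.Subset using (Subset; inside; outside; ⁅_⁆; _∪_; ∣_∣)
import Data.Fin.Subset.Properties as Subsetₚ
open import Data.Integer.Base as ℤ using (ℤ; +_; -[1+_]; +[1+_])
import Data.Integer.Properties as ℤₚ
import Data.Integer.Tactic.RingSolver as ℤ-Solver
open import Data.List.Base as List using (List; []; _∷_; _++_; length; filterᵇ)
open import Data.List.Membership.Propositional using (_∈_)
open import Data.List.Membership.Propositional.Properties
  using (∈-cartesianProductWith⁻; ∈-cartesianProductWith⁺; ∈-concat⁺′; ∈-concat⁻′; ∈-filter⁺;
         ∈-++⁺ˡ; ∈-++⁺ʳ; ∈-++⁻; ∈-map⁺; ∈-map⁻; ∈-tabulate⁺; ∈-tabulate⁻)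
open import Data.List.Relation.Unary.All as All using (All; []; _∷_)
import Data.List.Relation.Unary.All.Properties as Allₚ
open import Data.List.Relation.Unary.AllPairs using ([]; _∷_)
open import Data.List.Relation.Unary.Any as Any using (here; there)
import Data.List.Relation.Unary.Any.Properties as Anyₚ
open import Data.List.Relation.Unary.Unique.Propositional using (Unique)
import Data.List.Relation.Unary.Unique.Propositional.Properties as Uniqueₚ
open import Data.Nat.Base as ℕ using (ℕ; zero; suc; s≤s; z≤n)
import Data.Nat.ListAction as ℕL
import Data.Nat.Properties as ℕₚ
import Data.Nat.Tactic.RingSolver as ℕ-Solver
open import Data.Product.Base using (∃; ∃₂; _×_; _,_; proj₁; proj₂)
open import Data.Rational.Base as ℚ using (ℚ; 0ℚ; 1ℚ; ½; mkℚ; _/_; _-_)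
import Data.Rational.Properties as ℚₚ
open import Data.Rational.Solver using (module +-*-Solver)
import Data.Rational.Unnormalised.Base as ℚᵘ
import Data.Rational.Unnormalised.Properties as ℚᵘₚ
open import Data.Sum.Base using (_⊎_; inj₁; inj₂)
open import Data.Unit.Base using (tt)
open import Data.Vec.Base as Vec using (Vec; []; _∷_; lookup; insertAt)
import Data.Vec.Properties as Vecₚ
open import Function.Base using (_∘_)
open import Relation.Binary.Definitions using (DecidableEquality)
open import Relation.Binary.PropositionalEquality
  using (_≡_; _≢_; refl; sym; trans; cong; cong₂; subst; subst₂; module ≡-Reasoning)
open import Relation.Nullary using (yes; no; contradiction; does; ¬_)
open import Relation.Nullary.Decidable using (dec-true; dec-false)

-- The order of Cauchy reals is undecidable, so every decision is made on integers: elimination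
-- yields either a matching or a cover, each with a common denominator, and the hypothesis on
-- ρ(N_H(v)) is weakened to a rational θ lying below it and not below the threshold. Reals enter
-- only through the rational terms of an eigenvector at one late index, and as constant sequences in
-- the final matching. The threshold is the spectral radius of a complete graph on s vertices joined
-- to n - s - 1 independent ones, that is, of the layering with a = s. The competing extreme a = 0,
-- b = 2 s + 1 is a clique of spectral radius 2 s, and n ≥ 3 s + 3 is exactly the condition that 2 s
-- does not exceed the threshold. The test vector has to handle all layerings between these two,
-- including a = 0, where its general formula degenerates.

module ℕSum where
  open MonoidSum ℕₚ.+-0-commutativeMonoid public
  open SemiringSum ℕₚ.+-*-semiring public using (*-distribˡ-sum; *-distribʳ-sum)

module ℚSum where
  open MonoidSum ℚₚ.+-0-commutativeMonoid public
  open SemiringSum (CommutativeRing.semiring ℚₚ.+-*-commutativeRing) public using (*-distribˡ-sum; *-distribʳ-sum)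

-- Integer vectors and dot products.

infixl 6 _⊕_
infixl 7 _⊙_

_⊕_ : ∀ {k} → Vec ℤ k → Vec ℤ k → Vec ℤ k
_⊕_ = Vec.zipWith ℤ._+_

_⊙_ : ∀ {k} → ℕ → Vec ℤ k → Vec ℤ k
m ⊙ c = Vec.map ((+ m) ℤ.*_) c

dot : ∀ {k} → Vec ℤ k → Vec ℤ k → ℤ
dot []       []       = + 0
dot (a ∷ c) (x ∷ xs) = a ℤ.* x ℤ.+ dot c xs

dot-⊕ : ∀ {k} (c d x : Vec ℤ k) → dot (c ⊕ d) x ≡ dot c x ℤ.+ dot d x
dot-⊕ [] [] [] = refl
dot-⊕ (a ∷ c) (b ∷ d) (x ∷ xs) rewrite dot-⊕ c d xs = lemma a b x (dot c xs) (dot d xs)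
  where
  lemma : ∀ a b x p q → (a ℤ.+ b) ℤ.* x ℤ.+ (p ℤ.+ q) ≡ (a ℤ.* x ℤ.+ p) ℤ.+ (b ℤ.* x ℤ.+ q)
  lemma = ℤ-Solver.solve-∀

dot-⊙ˡ : ∀ {k} m (c x : Vec ℤ k) → dot (m ⊙ c) x ≡ (+ m) ℤ.* dot c x
dot-⊙ˡ m [] [] = sym (ℤₚ.*-zeroʳ (+ m))
dot-⊙ˡ m (a ∷ c) (x ∷ xs) rewrite dot-⊙ˡ m c xs = lemma (+ m) a x (dot c xs)
  where
  lemma : ∀ m a x p → m ℤ.* a ℤ.* x ℤ.+ m ℤ.* p ≡ m ℤ.* (a ℤ.* x ℤ.+ p)
  lemma = ℤ-Solver.solve-∀

dot-⊙ʳ : ∀ {k} m (c x : Vec ℤ k) → dot c (m ⊙ x) ≡ (+ m) ℤ.* dot c x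
dot-⊙ʳ m [] [] = sym (ℤₚ.*-zeroʳ (+ m))
dot-⊙ʳ m (a ∷ c) (x ∷ xs) rewrite dot-⊙ʳ m c xs = lemma (+ m) a x (dot c xs)
  where
  lemma : ∀ m a x p → a ℤ.* (m ℤ.* x) ℤ.+ m ℤ.* p ≡ m ℤ.* (a ℤ.* x ℤ.+ p)
  lemma = ℤ-Solver.solve-∀

-- Fourier–Motzkin elimination

-- A row β ∷ c stands for the inequality β * L + c · x ≤ 0 in the unknowns
-- L > 0 and x, that is, for the affine inequality c · (x / L) ≤ - β.
Row : ℕ → Set
Row k = Vec ℤ (suc k)

pivotEntry : ∀ {k} → Row (suc k) → ℤ
pivotEntry (_ ∷ α ∷ _) = α

rest : ∀ {k} → Row (suc k) → Row k
rest (β ∷ _ ∷ c) = β ∷ c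

-- All ordered pairs of rows are tried, so only positive-then-negative pivots need a result; the
-- reverse order would repeat it. A row with pivot zero survives because it is paired at least with
-- itself.
combine : ∀ {k} → Row (suc k) → Row (suc k) → List (Row k)
combine (β ∷ + 0      ∷ c) _                     = (β ∷ c) ∷ []
combine (β ∷ +[1+ m ] ∷ c) (β′ ∷ -[1+ l ] ∷ c′) =
  (suc l ⊙ (β ∷ c) ⊕ suc m ⊙ (β′ ∷ c′)) ∷ []
combine _ _ = []

eliminate : ∀ {k} → List (Row (suc k)) → List (Row k)
eliminate S = List.concat (List.cartesianProductWith combine S S)

Solvable : ∀ {k} → List (Row k) → Set
Solvable {k} S = ∃₂ λ L (x : Vec ℤ k) →
  (+ 0 ℤ.< L) × (∀ {c} → c ∈ S → dot c (L ∷ x) ℤ.≤ + 0)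

dot-pivot : ∀ {k} (c : Row (suc k)) L x y → dot c (L ∷ x ∷ y) ≡ pivotEntry c ℤ.* x ℤ.+ dot (rest c) (L ∷ y)
dot-pivot (β ∷ α ∷ c) L x y = lemma β α L x (dot c y)
  where
  lemma : ∀ β α L x p → β ℤ.* L ℤ.+ (α ℤ.* x ℤ.+ p) ≡ α ℤ.* x ℤ.+ (β ℤ.* L ℤ.+ p)
  lemma = ℤ-Solver.solve-∀

module _ {k} (e : Row (suc k) → ℤ) where

  -- With pivot -(l + 1) the row says x ≥ e c / (l + 1). Unnormalised rationals compare by cross
  -- multiplication, the very integer inequality that `extend` needs.
  lowerBound : Row (suc k) → ℕ → ℚᵘ.ℚᵘ
  lowerBound c l = ℚᵘ.mkℚᵘ (e c) l

  lowerBound-≤ : ∀ c {l l′ q} → pivotEntry c ≡ -[1+ l ] → pivotEntry c ≡ -[1+ l′ ] →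
    lowerBound c l ℚᵘ.≤ q → lowerBound c l′ ℚᵘ.≤ q
  lowerBound-≤ c eq eq′ = subst (λ l → lowerBound c l ℚᵘ.≤ _) (ℤₚ.-[1+-injective (trans (sym eq) eq′))

  maxLowerBound : ∀ S →
    (∀ {c} → c ∈ S → ∀ l → pivotEntry c ≢ -[1+ l ]) ⊎
    (∃₂ λ d m → d ∈ S × pivotEntry d ≡ -[1+ m ] ×
      (∀ {c} → c ∈ S → ∀ l → pivotEntry c ≡ -[1+ l ] → lowerBound c l ℚᵘ.≤ lowerBound d m))
  maxLowerBound [] = inj₁ λ ()
  maxLowerBound (c ∷ S) with pivotEntry c in eq | maxLowerBound S
  ... | + _ | inj₁ none = inj₁ λ
    { (here refl) l eq′ → contradiction (trans (sym eq) eq′) λ ()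
    ; (there c∈S)       → none c∈S }
  ... | + _ | inj₂ (d , m , d∈S , eqd , max) = inj₂ (d , m , there d∈S , eqd , λ
    { (here refl) l eq′ → contradiction (trans (sym eq) eq′) λ ()
    ; (there c∈S)       → max c∈S })
  ... | -[1+ l ] | inj₁ none = inj₂ (c , l , here refl , eq , λ
    { (here refl) l′ eq′ → lowerBound-≤ c eq eq′ ℚᵘₚ.≤-refl
    ; (there c∈S) l′ eq′ → contradiction eq′ (none c∈S l′) })
  ... | -[1+ l ] | inj₂ (d , m , d∈S , eqd , max) with ℚᵘₚ.≤-total (lowerBound c l) (lowerBound d m)
  ... | inj₁ c≤d = inj₂ (d , m , there d∈S , eqd , λ
    { (here refl) l′ eq′ → lowerBound-≤ c eq eq′ c≤d
    ; (there c∈S)        → max c∈S })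
  ... | inj₂ d≤c = inj₂ (c , l , here refl , eq , λ
    { (here refl) l′ eq′ → lowerBound-≤ c eq eq′ ℚᵘₚ.≤-refl
    ; (there c∈S) l′ eq′ → ℚᵘₚ.≤-trans (max c∈S l′ eq′) d≤c })

combine-opposite : ∀ {k a m} (c d : Row (suc k)) → pivotEntry c ≡ +[1+ a ] → pivotEntry d ≡ -[1+ m ] →
  (suc m ⊙ rest c ⊕ suc a ⊙ rest d) ∈ combine c d
combine-opposite (_ ∷ +[1+ _ ] ∷ _) (_ ∷ -[1+ _ ] ∷ _) refl refl = here refl

combine-∈ : ∀ {k} {S : List (Row (suc k))} {c d r} → c ∈ S → d ∈ S → r ∈ combine c d → r ∈ eliminate S
combine-∈ c∈S d∈S r∈ = ∈-concat⁺′ r∈ (∈-cartesianProductWith⁺ combine c∈S d∈S)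

listSum : {A : Set} → (A → ℕ) → List A → ℕ
listSum f es = ℕL.sum (List.map f es)

∈⇒≤listSum : ∀ {A : Set} (f : A → ℕ) {a} {as : List A} → a ∈ as → f a ℕ.≤ listSum f as
∈⇒≤listSum f {as = _ ∷ _}  (here refl)  = ℕₚ.m≤m+n _ _
∈⇒≤listSum f {as = b ∷ _}  (there a∈as) = ℕₚ.≤-trans (∈⇒≤listSum f a∈as) (ℕₚ.m≤n+m _ (f b))

i≤+∣i∣ : ∀ i → i ℤ.≤ + ℤ.∣ i ∣
i≤+∣i∣ (+ n)    = ℤₚ.≤-refl
i≤+∣i∣ -[1+ n ] = ℤ.-≤+

extend : ∀ {k} (S : List (Row (suc k))) → Solvable (eliminate S) → Solvable S
extend {k} S (L , y , 0<L , sat) with maxLowerBound (λ c → dot (rest c) (L ∷ y)) S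
... | inj₁ none = L , x ∷ y , 0<L , λ {c} c∈S → subst (ℤ._≤ + 0) (sym (dot-pivot c L x y)) (bound c c∈S)
  where
  e : Row (suc k) → ℤ
  e c = dot (rest c) (L ∷ y)
  -- No row bounds x from below, and a positive pivot is at least 1, so x = - B outweighs every
  -- `e c` at once.
  B : ℕ
  B = listSum (λ c → ℤ.∣ e c ∣) S
  x : ℤ
  x = ℤ.- (+ B)
  bound : ∀ c → c ∈ S → pivotEntry c ℤ.* x ℤ.+ e c ℤ.≤ + 0
  bound (β ∷ + 0 ∷ c) c∈S = subst (ℤ._≤ + 0)
    (sym (trans (cong (ℤ._+ e (β ∷ + 0 ∷ c)) (ℤₚ.*-zeroˡ x)) (ℤₚ.+-identityˡ (e (β ∷ + 0 ∷ c)))))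
    (sat (combine-∈ c∈S c∈S (here refl)))
  bound r@(β ∷ +[1+ m ] ∷ c) c∈S = begin
    (+ suc m) ℤ.* x ℤ.+ e r
      ≡⟨ cong (ℤ._+ e r) (trans (sym (ℤₚ.neg-distribʳ-* (+ suc m) (+ B))) (cong ℤ.-_ (sym (ℤₚ.pos-* (suc m) B)))) ⟩
    ℤ.- (+ (suc m ℕ.* B)) ℤ.+ e r
      ≤⟨ ℤₚ.+-mono-≤ (ℤₚ.neg-mono-≤ (ℤ.+≤+ (ℕₚ.m≤m+n B (m ℕ.* B))))
           (ℤₚ.≤-trans (i≤+∣i∣ (e r)) (ℤ.+≤+ (∈⇒≤listSum (λ c → ℤ.∣ e c ∣) c∈S))) ⟩
    ℤ.- (+ B) ℤ.+ + B
      ≡⟨ ℤₚ.+-inverseˡ (+ B) ⟩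
    + 0 ∎
    where open ℤₚ.≤-Reasoning
  bound (β ∷ -[1+ l ] ∷ c) c∈S = contradiction refl (none c∈S l)
-- The coordinate takes the largest lower bound e d / (m + 1), kept integral by multiplying L and y
-- by m + 1. Rows with positive pivot hold by their combination with d, rows with negative pivot by
-- the maximality of d.
... | inj₂ (d , m , d∈S , eqd , max) = (+ suc m) ℤ.* L , x ∷ suc m ⊙ y , 0<L′ , λ {c} c∈S →
    subst (ℤ._≤ + 0) (sym (trans (dot-pivot c ((+ suc m) ℤ.* L) x (suc m ⊙ y))
      (cong (ℤ._+_ (pivotEntry c ℤ.* x)) (dot-⊙ʳ (suc m) (rest c) (L ∷ y))))) (bound c c∈S)
  where
  e : Row (suc k) → ℤ
  e c = dot (rest c) (L ∷ y)
  x : ℤ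
  x = e d
  0<L′ : + 0 ℤ.< (+ suc m) ℤ.* L
  0<L′ = subst (ℤ._< (+ suc m) ℤ.* L) (ℤₚ.*-zeroʳ (+ suc m)) (ℤₚ.*-monoˡ-<-pos (+ suc m) 0<L)
  bound : ∀ c → c ∈ S → pivotEntry c ℤ.* x ℤ.+ (+ suc m) ℤ.* e c ℤ.≤ + 0
  bound r@(β ∷ + 0 ∷ c) c∈S = begin
    (+ 0) ℤ.* x ℤ.+ (+ suc m) ℤ.* e r ≡⟨ cong (λ z → z ℤ.+ (+ suc m) ℤ.* e r) (ℤₚ.*-zeroˡ x) ⟩
    (+ 0) ℤ.+ (+ suc m) ℤ.* e r ≡⟨ ℤₚ.+-identityˡ _ ⟩
    (+ suc m) ℤ.* e r         ≤⟨ ℤₚ.*-monoˡ-≤-nonNeg (+ suc m) (sat (combine-∈ c∈S c∈S (here refl))) ⟩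
    (+ suc m) ℤ.* + 0         ≡⟨ ℤₚ.*-zeroʳ (+ suc m) ⟩
    + 0 ∎
    where open ℤₚ.≤-Reasoning
  bound r@(β ∷ +[1+ a ] ∷ c) c∈S = begin
    (+ suc a) ℤ.* x ℤ.+ (+ suc m) ℤ.* e r
      ≡⟨ ℤₚ.+-comm ((+ suc a) ℤ.* x) ((+ suc m) ℤ.* e r) ⟩
    (+ suc m) ℤ.* e r ℤ.+ (+ suc a) ℤ.* x
      ≡⟨ cong₂ ℤ._+_ (sym (dot-⊙ˡ (suc m) (β ∷ c) (L ∷ y))) (sym (dot-⊙ˡ (suc a) (rest d) (L ∷ y))) ⟩
    dot (suc m ⊙ (β ∷ c)) (L ∷ y) ℤ.+ dot (suc a ⊙ rest d) (L ∷ y)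
      ≡⟨ sym (dot-⊕ (suc m ⊙ (β ∷ c)) (suc a ⊙ rest d) (L ∷ y)) ⟩
    dot (suc m ⊙ (β ∷ c) ⊕ suc a ⊙ rest d) (L ∷ y)
      ≤⟨ sat (combine-∈ c∈S d∈S (combine-opposite r d refl eqd)) ⟩
    + 0 ∎
    where open ℤₚ.≤-Reasoning
  bound r@(β ∷ -[1+ l ] ∷ c) c∈S = begin
    -[1+ l ] ℤ.* x ℤ.+ (+ suc m) ℤ.* e r
      ≡⟨ cong₂ ℤ._+_ (sym (ℤₚ.neg-distribˡ-* (+ suc l) x)) (ℤₚ.*-comm (+ suc m) (e r)) ⟩
    ℤ.- ((+ suc l) ℤ.* x) ℤ.+ e r ℤ.* (+ suc m)
      ≤⟨ ℤₚ.+-monoʳ-≤ (ℤ.- ((+ suc l) ℤ.* x)) (ℚᵘₚ.drop-*≤* (max c∈S l refl)) ⟩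
    ℤ.- ((+ suc l) ℤ.* x) ℤ.+ x ℤ.* (+ suc l)
      ≡⟨ cong (ℤ._+ x ℤ.* (+ suc l)) (cong ℤ.-_ (ℤₚ.*-comm (+ suc l) x)) ⟩
    ℤ.- (x ℤ.* (+ suc l)) ℤ.+ x ℤ.* (+ suc l)
      ≡⟨ ℤₚ.+-inverseˡ (x ℤ.* (+ suc l)) ⟩
    + 0 ∎
    where open ℤₚ.≤-Reasoning

-- P stands for membership in the cone of nonnegative combinations of S.
farkas : ∀ {k} (P : Row k → Set) →
  (∀ c d → P c → P d → P (c ⊕ d)) → (∀ m c → P c → P (m ⊙ c)) →
  (S : List (Row k)) → (∀ {c} → c ∈ S → P c) →
  Solvable S ⊎ (∃ λ β → (+ 0 ℤ.< β) × P (β ∷ Vec.replicate k (+ 0)))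
farkas {zero} P _ _ S PS = base S PS
  where
  base : (S : List (Row 0)) → (∀ {c} → c ∈ S → P c) → Solvable S ⊎ (∃ λ β → (+ 0 ℤ.< β) × P (β ∷ []))
  base [] _ = inj₁ (+ 1 , [] , ℤ.+<+ (ℕ.s≤s ℕ.z≤n) , λ ())
  base ((β ∷ []) ∷ S) PS with (+ 0) ℤₚ.<? β
  ... | yes 0<β = inj₂ (β , 0<β , PS (here refl))
  ... | no  β≤0 with base S (λ c∈S → PS (there c∈S))
  ... | inj₂ certificate = inj₂ certificate
  ... | inj₁ (L , [] , 0<L , sat) = inj₁ (L , [] , 0<L , λ
    { (here refl) → subst₂ ℤ._≤_ (sym (ℤₚ.+-identityʳ (β ℤ.* L))) (ℤₚ.*-zeroˡ L)
        (ℤₚ.*-monoʳ-≤-nonNeg L {{ℤ.nonNegative (ℤₚ.<⇒≤ 0<L)}} (ℤₚ.≮⇒≥ β≤0))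
    ; (there c∈S) → sat c∈S })
farkas {suc k} P P-⊕ P-⊙ S PS with farkas P₀ P₀-⊕ P₀-⊙ (eliminate S) PS₀
  where
  -- Eliminated rows lie in the cone once padded with a zero pivot, so the induction runs on `P`
  -- restricted to such rows.
  P₀ : Row k → Set
  P₀ (β ∷ c) = P (β ∷ + 0 ∷ c)
  P₀-⊕ : ∀ c d → P₀ c → P₀ d → P₀ (c ⊕ d)
  P₀-⊕ (β ∷ c) (β′ ∷ d) = P-⊕ (β ∷ + 0 ∷ c) (β′ ∷ + 0 ∷ d)
  P₀-⊙ : ∀ m c → P₀ c → P₀ (m ⊙ c)
  P₀-⊙ m (β ∷ c) p = subst (λ z → P ((+ m) ℤ.* β ∷ z ∷ m ⊙ c)) (ℤₚ.*-zeroʳ (+ m)) (P-⊙ m (β ∷ + 0 ∷ c) p)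
  PS-combine : ∀ c d → P c → P d → ∀ {r} → r ∈ combine c d → P₀ r
  PS-combine (β ∷ + 0 ∷ c) d p q (here refl) = p
  PS-combine (β ∷ +[1+ m ] ∷ c) (β′ ∷ -[1+ l ] ∷ c′) p q (here refl) =
    subst (λ z → P ((+ suc l) ℤ.* β ℤ.+ (+ suc m) ℤ.* β′ ∷ z ∷ suc l ⊙ c ⊕ suc m ⊙ c′)) cancel
      (P-⊕ _ _ (P-⊙ (suc l) _ p) (P-⊙ (suc m) _ q))
    where
    cancel : (+ suc l) ℤ.* (+ suc m) ℤ.+ (+ suc m) ℤ.* -[1+ l ] ≡ + 0
    cancel = trans (cong₂ ℤ._+_ (ℤₚ.*-comm (+ suc l) (+ suc m)) (sym (ℤₚ.neg-distribʳ-* (+ suc m) (+ suc l))))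
      (ℤₚ.+-inverseʳ ((+ suc m) ℤ.* (+ suc l)))
  PS-combine (β ∷ +[1+ m ] ∷ c) (β′ ∷ + _ ∷ c′) p q ()
  PS-combine (β ∷ -[1+ m ] ∷ c) _ p q ()
  PS₀ : ∀ {r} → r ∈ eliminate S → P₀ r
  PS₀ {r} r∈ with ∈-concat⁻′ (List.cartesianProductWith combine S S) r∈
  ... | rs , r∈rs , rs∈ with ∈-cartesianProductWith⁻ combine S S rs∈
  ... | c , d , c∈S , d∈S , refl = PS-combine c d (PS c∈S) (PS d∈S) r∈rs
... | inj₁ sol = inj₁ (extend S sol)
... | inj₂ (β , 0<β , p) = inj₂ (β , 0<β , p)

module _ where
  open import Data.Nat.Base using (_+_; _*_; _∸_; _≤_; _<_)
  open ℕSum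

  -- Linear programming duality

  𝟙 : Bool → ℕ
  𝟙 true  = 1
  𝟙 false = 0

  weight : ∀ {n} → (Fin n → ℕ) → Subset n → ℕ
  weight w e = sum (λ v → 𝟙 (lookup e v) ℕ.* w v)

  weight-+ : ∀ {n} (w w′ : Fin n → ℕ) e → weight (λ v → w v ℕ.+ w′ v) e ≡ weight w e ℕ.+ weight w′ e
  weight-+ w w′ e = trans
    (sum-cong-≗ (λ v → ℕₚ.*-distribˡ-+ (𝟙 (lookup e v)) (w v) (w′ v)))
    (∑-distrib-+ (λ v → 𝟙 (lookup e v) ℕ.* w v) (λ v → 𝟙 (lookup e v) ℕ.* w′ v))

  weight-* : ∀ {n} m (w : Fin n → ℕ) e → weight (λ v → m ℕ.* w v) e ≡ m ℕ.* weight w e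
  weight-* m w e = trans
    (sum-cong-≗ (λ v → swap (𝟙 (lookup e v)) m (w v)))
    (sym (*-distribˡ-sum m (λ v → 𝟙 (lookup e v) ℕ.* w v)))
    where
    swap : ∀ a b c → a ℕ.* (b ℕ.* c) ≡ b ℕ.* (a ℕ.* c)
    swap = ℕ-Solver.solve-∀

  weight-0 : ∀ {n} (e : Subset n) → weight (λ _ → 0) e ≡ 0
  weight-0 {n} e = trans (sum-cong-≗ (λ v → ℕₚ.*-zeroʳ (𝟙 (lookup e v)))) (sum-replicate-zero n)

  δ : ∀ {n} → Fin n → Fin n → ℕ
  δ u v = 𝟙 (does (u Finₚ.≟ v))

  sum-*-δ : ∀ {n} (g : Fin n → ℕ) u → sum (λ v → g v ℕ.* δ u v) ≡ g u
  sum-*-δ {suc n} g zero = begin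
    g zero ℕ.* 1 ℕ.+ sum (λ v → g (suc v) ℕ.* 0)
      ≡⟨ cong₂ ℕ._+_ (ℕₚ.*-identityʳ (g zero)) (sum-cong-≗ (λ v → ℕₚ.*-zeroʳ (g (suc v)))) ⟩
    g zero ℕ.+ sum {n} (λ _ → 0)
      ≡⟨ cong (ℕ._+_ (g zero)) (sum-replicate-zero n) ⟩
    g zero ℕ.+ 0
      ≡⟨ ℕₚ.+-identityʳ (g zero) ⟩
    g zero ∎
    where open ≡-Reasoning
  sum-*-δ {suc n} g (suc u) rewrite ℕₚ.*-zeroʳ (g zero) = sum-*-δ (g ∘ suc) u

  -- The negated basis vector: rows are inequalities of the form ≤ 0, and this one expresses that a
  -- coordinate is nonnegative.
  unit : ∀ {k} → Fin k → Vec ℤ k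
  unit {suc k} zero    = -[1+ 0 ] ∷ Vec.replicate k (+ 0)
  unit {suc k} (suc i) = + 0 ∷ unit i

  dot-0 : ∀ {k} (x : Vec ℤ k) → dot (Vec.replicate k (+ 0)) x ≡ + 0
  dot-0 []       = refl
  dot-0 (x ∷ xs) = trans (ℤₚ.+-identityˡ (dot (Vec.replicate _ (+ 0)) xs)) (dot-0 xs)

  dot-unit : ∀ {k} (i : Fin k) x → dot (unit i) x ≡ ℤ.- lookup x i
  dot-unit zero    (x ∷ xs) = trans (cong₂ ℤ._+_ (ℤₚ.-1*i≡-i x) (dot-0 xs)) (ℤₚ.+-identityʳ (ℤ.- x))
  dot-unit (suc i) (x ∷ xs) = trans (ℤₚ.+-identityˡ (dot (unit i) xs)) (dot-unit i xs)

  unit≤0 : ∀ {k} (i j : Fin k) → lookup (unit i) j ℤ.≤ + 0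
  unit≤0 zero    zero    = ℤ.-≤+
  unit≤0 zero    (suc j) = ℤₚ.≤-reflexive (Vecₚ.lookup-replicate j (+ 0))
  unit≤0 (suc i) zero    = ℤₚ.≤-refl
  unit≤0 (suc i) (suc j) = unit≤0 i j

  listSum-cong : ∀ {A : Set} {f g : A → ℕ} {es} → All (λ e → f e ≡ g e) es → listSum f es ≡ listSum g es
  listSum-cong []       = refl
  listSum-cong (p ∷ ps) = cong₂ ℕ._+_ p (listSum-cong ps)

  module _ {A : Set} (_≟_ : DecidableEquality A) where

    -- A solution gives one number per position; it becomes a function on edges because distinct
    -- positions carry distinct edges. One f serves all g: indicators of a vertex for the vertex
    -- rows, the constant 1 for the size row.
    valuation : (es : List A) → Unique es → (x : Vec ℤ (length es)) → (∀ i → + 0 ℤ.≤ lookup x i) →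
      ∃ λ (f : A → ℕ) → ∀ (g : A → ℕ) →
        dot (Vec.map (+_ ∘ g) (Vec.fromList es)) x ≡ + listSum (λ e → g e ℕ.* f e) es
    valuation [] _ [] _ = (λ _ → 0) , λ _ → refl
    valuation (e ∷ es) (e∉es ∷ unique) (x ∷ xs) 0≤x with x | 0≤x zero | valuation es unique xs (0≤x ∘ suc)
    ... | + y | _ | f , f-spec = f′ , λ g → begin
      (+ g e) ℤ.* (+ y) ℤ.+ dot (Vec.map (+_ ∘ g) (Vec.fromList es)) xs
        ≡⟨ cong₂ ℤ._+_ (sym (ℤₚ.pos-* (g e) y)) (f-spec g) ⟩
      + (g e ℕ.* y ℕ.+ listSum (λ e → g e ℕ.* f e) es)
        ≡⟨ cong +_ (cong₂ ℕ._+_ (cong (g e ℕ.*_) (sym f′-head)) (listSum-cong (All.map (λ ≢ → cong (g _ ℕ.*_) (sym (f′-tail ≢))) e∉es))) ⟩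
      + listSum (λ e → g e ℕ.* f′ e) (e ∷ es) ∎
      where
      open ≡-Reasoning
      f′ : A → ℕ
      f′ a = if does (e ≟ a) then y else f a
      f′-head : f′ e ≡ y
      f′-head rewrite dec-true (e ≟ e) refl = refl
      f′-tail : ∀ {a} → e ≢ a → f′ a ≡ f a
      f′-tail {a} ≢ rewrite dec-false (e ≟ a) ≢ = refl

  dot-neg : ∀ {A : Set} {k} (g : A → ℤ) (es : Vec A k) x → dot (Vec.map (ℤ.-_ ∘ g) es) x ≡ ℤ.- dot (Vec.map g es) x
  dot-neg g [] [] = refl
  dot-neg g (e ∷ es) (x ∷ xs) rewrite dot-neg g es xs = lemma (g e) x (dot (Vec.map g es) xs)
    where
    lemma : ∀ a x p → ℤ.- a ℤ.* x ℤ.+ ℤ.- p ≡ ℤ.- (a ℤ.* x ℤ.+ p)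
    lemma = ℤ-Solver.solve-∀

  -- With a common denominator L the values f e / L form a fractional matching
  -- of size at least c; the values w v / D form a fractional vertex cover of
  -- size less than c.
  FractionalMatching : ∀ {n} → List (Subset n) → ℕ → Set
  FractionalMatching {n} es c = ∃₂ λ (f : Subset n → ℕ) L → 0 ℕ.< L ×
    (∀ v → listSum (λ e → 𝟙 (lookup e v) ℕ.* f e) es ℕ.≤ L) × c ℕ.* L ℕ.≤ listSum f es

  FractionalCover : ∀ {n} → List (Subset n) → ℕ → Set
  FractionalCover {n} es c = ∃₂ λ (w : Fin n → ℕ) D →
    (∀ {e} → e ∈ es → D ℕ.≤ weight w e) × sum w ℕ.< c ℕ.* D

  _≟ˢ_ : ∀ {n} → DecidableEquality (Subset n)
  _≟ˢ_ = Vecₚ.≡-dec _≟ᵇ_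

  module Duality {n} (es : List (Subset n)) (unique : Unique es) (c : ℕ) where

    k : ℕ
    k = length es

    esᵛ : Vec (Subset n) k
    esᵛ = Vec.fromList es

    vertexRow : Fin n → Row k
    vertexRow v = -[1+ 0 ] ∷ Vec.map (+_ ∘ λ e → 𝟙 (lookup e v)) esᵛ

    sizeRow : Row k
    sizeRow = + c ∷ Vec.map (ℤ.-_ ∘ λ _ → + 1) esᵛ

    nonnegRow : Fin k → Row k
    nonnegRow i = + 0 ∷ unit i

    system : List (Row k)
    system = sizeRow ∷ List.tabulate vertexRow ++ List.tabulate nonnegRow

    slack : (Fin n → ℕ) → ℕ → Subset n → ℤ
    slack w D e = + weight w e ℤ.- + D

    -- Rows of this form are what a multiplier D of the size row and w v of
    -- the vertex rows can produce, the nonnegativity rows being absorbed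
    -- in the inequalities.
    IsCoverRow : Row k → Set
    IsCoverRow (β ∷ a) = ∃₂ λ (w : Fin n → ℕ) D →
      (β ℤ.≤ (+ c) ℤ.* + D ℤ.- + sum w) × (∀ i → lookup a i ℤ.≤ slack w D (lookup esᵛ i))

    isCoverRow-⊕ : ∀ a b → IsCoverRow a → IsCoverRow b → IsCoverRow (a ⊕ b)
    isCoverRow-⊕ (β ∷ a) (β′ ∷ b) (w , D , β≤ , a≤) (w′ , D′ , β′≤ , b≤) =
      (λ v → w v ℕ.+ w′ v) , D ℕ.+ D′ ,
      ℤₚ.≤-trans (ℤₚ.+-mono-≤ β≤ β′≤) (ℤₚ.≤-reflexive (trans
        (regroup (+ c) (+ D) (+ sum w) (+ D′) (+ sum w′))
        (cong (λ z → (+ c) ℤ.* (+ D ℤ.+ + D′) ℤ.- + z) (sym (∑-distrib-+ w w′))))) ,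
      λ i → ℤₚ.≤-trans (ℤₚ.≤-reflexive (Vecₚ.lookup-zipWith ℤ._+_ i a b))
        (ℤₚ.≤-trans (ℤₚ.+-mono-≤ (a≤ i) (b≤ i)) (ℤₚ.≤-reflexive (trans
          (regroup′ (+ weight w (lookup esᵛ i)) (+ D) (+ weight w′ (lookup esᵛ i)) (+ D′))
          (cong (λ z → + z ℤ.- (+ D ℤ.+ + D′)) (sym (weight-+ w w′ (lookup esᵛ i)))))))
      where
      regroup : ∀ c d s d′ s′ → (c ℤ.* d ℤ.- s) ℤ.+ (c ℤ.* d′ ℤ.- s′) ≡ c ℤ.* (d ℤ.+ d′) ℤ.- (s ℤ.+ s′)
      regroup = ℤ-Solver.solve-∀
      regroup′ : ∀ s d s′ d′ → (s ℤ.- d) ℤ.+ (s′ ℤ.- d′) ≡ (s ℤ.+ s′) ℤ.- (d ℤ.+ d′)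
      regroup′ = ℤ-Solver.solve-∀

    isCoverRow-⊙ : ∀ m a → IsCoverRow a → IsCoverRow (m ⊙ a)
    isCoverRow-⊙ m (β ∷ a) (w , D , β≤ , a≤) =
      (λ v → m ℕ.* w v) , m ℕ.* D ,
      ℤₚ.≤-trans (ℤₚ.*-monoˡ-≤-nonNeg (+ m) β≤) (ℤₚ.≤-reflexive (trans
        (regroup (+ m) (+ c) (+ D) (+ sum w))
        (cong₂ (λ y z → (+ c) ℤ.* y ℤ.- z) (sym (ℤₚ.pos-* m D))
          (trans (sym (ℤₚ.pos-* m (sum w))) (cong +_ (*-distribˡ-sum m w)))))) ,
      λ i → ℤₚ.≤-trans (ℤₚ.≤-reflexive (Vecₚ.lookup-map i _ a))
        (ℤₚ.≤-trans (ℤₚ.*-monoˡ-≤-nonNeg (+ m) (a≤ i)) (ℤₚ.≤-reflexive (trans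
          (regroup′ (+ m) (+ weight w (lookup esᵛ i)) (+ D))
          (cong₂ (λ y z → y ℤ.- z)
            (trans (sym (ℤₚ.pos-* m _)) (cong +_ (sym (weight-* m w (lookup esᵛ i)))))
            (sym (ℤₚ.pos-* m D))))))
      where
      regroup : ∀ m c d s → m ℤ.* (c ℤ.* d ℤ.- s) ≡ c ℤ.* (m ℤ.* d) ℤ.- m ℤ.* s
      regroup = ℤ-Solver.solve-∀
      regroup′ : ∀ m s d → m ℤ.* (s ℤ.- d) ≡ m ℤ.* s ℤ.- m ℤ.* d
      regroup′ = ℤ-Solver.solve-∀

    isCoverRow-vertexRow : ∀ v → IsCoverRow (vertexRow v)
    isCoverRow-vertexRow v = δ v , 0 ,
      ℤₚ.≤-reflexive (sym (cong₂ (λ y z → y ℤ.- + z) (ℤₚ.*-zeroʳ (+ c)) total)) ,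
      λ i → ℤₚ.≤-reflexive (trans (Vecₚ.lookup-map i _ esᵛ) (sym (trans (ℤₚ.+-identityʳ _)
        (cong +_ (sum-*-δ (λ u → 𝟙 (lookup (lookup esᵛ i) u)) v)))))
      where
      total : sum (δ v) ≡ 1
      total = trans (sum-cong-≗ (λ u → sym (ℕₚ.*-identityˡ (δ v u)))) (sum-*-δ (λ _ → 1) v)

    isCoverRow-sizeRow : IsCoverRow sizeRow
    isCoverRow-sizeRow = (λ _ → 0) , 1 ,
      ℤₚ.≤-reflexive (sym (trans (cong₂ (λ y z → y ℤ.- + z) (ℤₚ.*-identityʳ (+ c)) (sum-replicate-zero n)) (ℤₚ.+-identityʳ (+ c)))) ,
      λ i → ℤₚ.≤-reflexive (trans (Vecₚ.lookup-map i _ esᵛ) (cong (λ z → + z ℤ.- + 1) (sym (weight-0 (lookup esᵛ i)))))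

    isCoverRow-nonnegRow : ∀ i → IsCoverRow (nonnegRow i)
    isCoverRow-nonnegRow i = (λ _ → 0) , 0 ,
      ℤₚ.≤-reflexive (sym (cong₂ (λ y z → y ℤ.- + z) (ℤₚ.*-zeroʳ (+ c)) (sum-replicate-zero n))) ,
      λ j → ℤₚ.≤-trans (unit≤0 i j) (ℤₚ.≤-reflexive (cong (λ z → + z ℤ.- + 0) (sym (weight-0 (lookup esᵛ j)))))

    isCoverRow-system : ∀ {a} → a ∈ system → IsCoverRow a
    isCoverRow-system (here refl) = isCoverRow-sizeRow
    isCoverRow-system (there a∈) with ∈-++⁻ (List.tabulate vertexRow) a∈
    ... | inj₁ a∈′ with v , refl ← ∈-tabulate⁻ a∈′ = isCoverRow-vertexRow v
    ... | inj₂ a∈′ with i , refl ← ∈-tabulate⁻ a∈′ = isCoverRow-nonnegRow i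

    matching : Solvable system → FractionalMatching es c
    matching (-[1+ _ ] , _ , () , _)
    matching (+ L , x , 0<L , sat) = f , L , ℤₚ.drop‿+<+ 0<L , vertex , total
      where
      nonneg : ∀ i → + 0 ℤ.≤ lookup x i
      nonneg i = ℤₚ.neg-cancel-≤ (subst (ℤ._≤ + 0) (trans (ℤₚ.+-identityˡ (dot (unit i) x)) (dot-unit i x))
        (sat (there (∈-++⁺ʳ (List.tabulate vertexRow) (∈-tabulate⁺ i)))))
      f-spec = valuation _≟ˢ_ es unique x nonneg
      f = proj₁ f-spec
      vertex : ∀ v → listSum (λ e → 𝟙 (lookup e v) ℕ.* f e) es ℕ.≤ L
      vertex v = ℤₚ.drop‿+≤+ (ℤₚ.i-j≤0⇒i≤j (subst (ℤ._≤ + 0)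
        (trans (cong₂ ℤ._+_ (ℤₚ.-1*i≡-i (+ L)) (proj₂ f-spec (λ e → 𝟙 (lookup e v))))
          (ℤₚ.+-comm (ℤ.- + L) (+ listSum (λ e → 𝟙 (lookup e v) ℕ.* f e) es)))
        (sat (there (∈-++⁺ˡ (∈-tabulate⁺ v))))))
      total : c ℕ.* L ℕ.≤ listSum f es
      total = subst (c ℕ.* L ℕ.≤_) (listSum-cong {es = es} (All.universal (λ e → ℕₚ.*-identityˡ (f e)) es))
        (ℤₚ.drop‿+≤+ (ℤₚ.i-j≤0⇒i≤j (subst (ℤ._≤ + 0)
          (cong₂ ℤ._+_ (sym (ℤₚ.pos-* c L)) (trans (dot-neg (λ _ → + 1) esᵛ x) (cong ℤ.-_ (proj₂ f-spec (λ _ → 1)))))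
          (sat (here refl)))))

    -- The zero coefficients read 0 ≤ weight w e - D for every edge e, and the positive β reads 0 <
    -- c D - sum w.
    cover : ∀ {β} → + 0 ℤ.< β → IsCoverRow (β ∷ Vec.replicate k (+ 0)) → FractionalCover es c
    cover {β} 0<β (w , D , β≤ , a≤) = w , D ,
      (λ e∈es → subst (λ e → D ℕ.≤ weight w e) (sym (Anyₚ.lookup-index e∈es)) (covered (Any.index e∈es))) ,
      ℤₚ.drop‿+<+ (ℤₚ.≰⇒> λ cD≤w → ℤₚ.<⇒≱ (subst (λ z → + 0 ℤ.< z ℤ.- + sum w) (sym (ℤₚ.pos-* c D)) (ℤₚ.<-≤-trans 0<β β≤)) (ℤₚ.i≤j⇒i-j≤0 cD≤w))
      where
      fromList-lookup : ∀ {A : Set} (xs : List A) i → lookup (Vec.fromList xs) i ≡ List.lookup xs i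
      fromList-lookup (x ∷ xs) zero    = refl
      fromList-lookup (x ∷ xs) (suc i) = fromList-lookup xs i
      covered : ∀ i → D ℕ.≤ weight w (List.lookup es i)
      covered i = ℤₚ.drop‿+≤+ (ℤₚ.0≤i-j⇒j≤i (subst₂ ℤ._≤_ (Vecₚ.lookup-replicate i (+ 0))
        (cong (slack w D) (fromList-lookup es i)) (a≤ i)))

    duality : FractionalMatching es c ⊎ FractionalCover es c
    duality with farkas IsCoverRow isCoverRow-⊕ isCoverRow-⊙ system isCoverRow-system
    ... | inj₁ solution            = inj₁ (matching solution)
    ... | inj₂ (β , 0<β , isCover) = inj₂ (cover 0<β isCover)

  subsets-unique : ∀ n → Unique (subsets n)
  subsets-unique zero    = [] ∷ []
  subsets-unique (suc n) = Uniqueₚ.++⁺ (Uniqueₚ.map⁺ Vecₚ.∷-injectiveʳ (subsets-unique n)) (Uniqueₚ.map⁺ Vecₚ.∷-injectiveʳ (subsets-unique n)) disjoint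
    where
    disjoint : ∀ {e} → (e ∈ List.map (outside ∷_) (subsets n)) × (e ∈ List.map (inside ∷_) (subsets n)) → _
    disjoint (p , q) with ∈-map⁻ (outside ∷_) p | ∈-map⁻ (inside ∷_) q
    ... | _ , _ , refl | _ , _ , ()

  subsets-complete : ∀ {n} (e : Subset n) → e ∈ subsets n
  subsets-complete []            = here refl
  subsets-complete (outside ∷ e) = ∈-++⁺ˡ (∈-map⁺ (outside ∷_) (subsets-complete e))
  subsets-complete (inside ∷ e)  = ∈-++⁺ʳ _ (∈-map⁺ (inside ∷_) (subsets-complete e))

  -- The cover of a link and its layers

  sum-mono : ∀ {n} {f g : Fin n → ℕ} → (∀ i → f i ≤ g i) → sum f ≤ sum g
  sum-mono {zero}  f≤g = z≤n
  sum-mono {suc n} f≤g = ℕₚ.+-mono-≤ (f≤g zero) (sum-mono (f≤g ∘ suc))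

  sum-const : ∀ n m → sum {n} (λ _ → m) ≡ n * m
  sum-const zero    m = refl
  sum-const (suc n) m = cong (_+_ m) (sum-const n m)

  Σ< : ℕ → (ℕ → ℕ) → ℕ
  Σ< zero    F = 0
  Σ< (suc d) F = Σ< d F + F d

  Σ<-+ : ∀ d F G → Σ< d (λ t → F t + G t) ≡ Σ< d F + Σ< d G
  Σ<-+ zero    F G = refl
  Σ<-+ (suc d) F G rewrite Σ<-+ d F G = lemma (Σ< d F) (Σ< d G) (F d) (G d)
    where
    lemma : ∀ a b x y → a + b + (x + y) ≡ a + x + (b + y)
    lemma = ℕ-Solver.solve-∀

  Σ<-sum-comm : ∀ {n} d (φ : Fin n → ℕ → ℕ) → Σ< d (λ t → sum (λ x → φ x t)) ≡ sum (λ x → Σ< d (φ x))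
  Σ<-sum-comm {n} zero φ = sym (sum-replicate-zero n)
  Σ<-sum-comm (suc d) φ rewrite Σ<-sum-comm d φ = sym (∑-distrib-+ (λ x → Σ< d (φ x)) (λ x → φ x d))

  -- Averaging over the thresholds: if the last term is at least C, deleting it leaves a sum below
  -- the bound for the remaining ones.
  Σ<-pigeonhole : ∀ d F C → Σ< d F < d * C → ∃ λ t → t < d × F t < C
  Σ<-pigeonhole (suc d) F C h with F d ℕₚ.<? C
  ... | yes Fd<C = d , ℕₚ.n<1+n d , Fd<C
  ... | no  Fd≮C with Σ<-pigeonhole d F C (ℕₚ.+-cancelʳ-< C (Σ< d F) (d * C) (begin-strict
      Σ< d F + C   ≤⟨ ℕₚ.+-monoʳ-≤ (Σ< d F) (ℕₚ.≮⇒≥ Fd≮C) ⟩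
      Σ< d F + F d <⟨ h ⟩
      C + d * C    ≡⟨ ℕₚ.+-comm C (d * C) ⟩
      d * C + C    ∎))
    where open ℕₚ.≤-Reasoning
  ... | t , t<d , Ft<C = t , ℕₚ.m<n⇒m<1+n t<d , Ft<C

  ⟦_≤_⟧ : ℕ → ℕ → ℕ
  ⟦ a ≤ b ⟧ = 𝟙 (does (a ℕₚ.≤? b))

  ⟦≤⟧-true : ∀ {a b} → a ≤ b → ⟦ a ≤ b ⟧ ≡ 1
  ⟦≤⟧-true {a} {b} a≤b rewrite dec-true (a ℕₚ.≤? b) a≤b = refl

  ⟦≤⟧-false : ∀ {a b} → ¬ (a ≤ b) → ⟦ a ≤ b ⟧ ≡ 0
  ⟦≤⟧-false {a} {b} a≰b rewrite dec-false (a ℕₚ.≤? b) a≰b = refl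

  𝟙≤1 : ∀ b → 𝟙 b ≤ 1
  𝟙≤1 true  = ℕₚ.≤-refl
  𝟙≤1 false = z≤n

  Σ<-≤-length : ∀ d m → Σ< d (λ t → ⟦ suc t ≤ m ⟧) ≤ d
  Σ<-≤-length zero    m = z≤n
  Σ<-≤-length (suc d) m = ℕₚ.≤-trans (ℕₚ.+-mono-≤ (Σ<-≤-length d m) (𝟙≤1 _)) (ℕₚ.≤-reflexive (ℕₚ.+-comm d 1))

  Σ<-below : ∀ d m → Σ< d (λ t → ⟦ suc t ≤ m ⟧) ≤ m
  Σ<-below zero    m = z≤n
  Σ<-below (suc d) m with suc d ℕₚ.≤? m
  ... | yes d<m = ℕₚ.≤-trans (ℕₚ.+-mono-≤ (Σ<-≤-length d m) (ℕₚ.≤-reflexive (⟦≤⟧-true d<m))) (ℕₚ.≤-trans (ℕₚ.≤-reflexive (ℕₚ.+-comm d 1)) d<m)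
  ... | no  d≮m = ℕₚ.≤-trans (ℕₚ.≤-reflexive (trans (cong (_+_ (Σ< d (λ t → ⟦ suc t ≤ m ⟧))) (⟦≤⟧-false d≮m)) (ℕₚ.+-identityʳ _))) (Σ<-below d m)

  Σ<-above : ∀ d K m → Σ< d (λ t → ⟦ K ≤ m + t ⟧) ≤ (m + d) ∸ K
  Σ<-above zero    K m = z≤n
  Σ<-above (suc d) K m with K ℕₚ.≤? m + d
  ... | yes K≤ = begin
    Σ< d (λ t → ⟦ K ≤ m + t ⟧) + ⟦ K ≤ m + d ⟧
      ≤⟨ ℕₚ.+-mono-≤ (Σ<-above d K m) (𝟙≤1 _) ⟩
    (m + d) ∸ K + 1
      ≡⟨ ℕₚ.+-comm ((m + d) ∸ K) 1 ⟩
    suc ((m + d) ∸ K)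
      ≡⟨ sym (ℕₚ.+-∸-assoc 1 K≤) ⟩
    suc (m + d) ∸ K
      ≡⟨ cong (_∸ K) (sym (ℕₚ.+-suc m d)) ⟩
    (m + suc d) ∸ K ∎
    where open ℕₚ.≤-Reasoning
  ... | no K≰ = begin
    Σ< d (λ t → ⟦ K ≤ m + t ⟧) + ⟦ K ≤ m + d ⟧
      ≡⟨ trans (cong (_+_ (Σ< d (λ t → ⟦ K ≤ m + t ⟧))) (⟦≤⟧-false K≰)) (ℕₚ.+-identityʳ _) ⟩
    Σ< d (λ t → ⟦ K ≤ m + t ⟧)
      ≤⟨ Σ<-above d K m ⟩
    (m + d) ∸ K
      ≤⟨ ℕₚ.∸-monoˡ-≤ K (ℕₚ.+-monoʳ-≤ m (ℕₚ.n≤1+n d)) ⟩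
    (m + suc d) ∸ K ∎
    where open ℕₚ.≤-Reasoning

  -- Here m stands for 2 w x. At most m - D thresholds (none if m ≤ D) satisfy the first condition
  -- and at most min(m, D) the second; in either order of m and D the two counts add up to at most
  -- m.
  thresholdCount : ∀ D m → Σ< D (λ t → ⟦ D + D ≤ m + t ⟧ + ⟦ suc t ≤ m ⟧) ≤ m
  thresholdCount D m = begin
    Σ< D (λ t → ⟦ D + D ≤ m + t ⟧ + ⟦ suc t ≤ m ⟧)
      ≡⟨ Σ<-+ D (λ t → ⟦ D + D ≤ m + t ⟧) (λ t → ⟦ suc t ≤ m ⟧) ⟩
    Σ< D (λ t → ⟦ D + D ≤ m + t ⟧) + Σ< D (λ t → ⟦ suc t ≤ m ⟧)
      ≤⟨ ℕₚ.+-monoˡ-≤ _ (Σ<-above D (D + D) m) ⟩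
    ((m + D) ∸ (D + D)) + Σ< D (λ t → ⟦ suc t ≤ m ⟧)
      ≡⟨ cong (_+ Σ< D (λ t → ⟦ suc t ≤ m ⟧)) (trans (cong (_∸ (D + D)) (ℕₚ.+-comm m D)) (ℕₚ.[m+n]∸[m+o]≡n∸o D m D)) ⟩
    (m ∸ D) + Σ< D (λ t → ⟦ suc t ≤ m ⟧)
      ≤⟨ final ⟩
    m ∎
    where
    open ℕₚ.≤-Reasoning
    final : (m ∸ D) + Σ< D (λ t → ⟦ suc t ≤ m ⟧) ≤ m
    final with ℕₚ.≤-total D m
    ... | inj₁ D≤m = ℕₚ.≤-trans (ℕₚ.+-monoʳ-≤ (m ∸ D) (Σ<-≤-length D m)) (ℕₚ.≤-reflexive (ℕₚ.m∸n+n≡m D≤m))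
    ... | inj₂ m≤D = ℕₚ.≤-trans (ℕₚ.+-mono-≤ (ℕₚ.≤-reflexive (ℕₚ.m≤n⇒m∸n≡0 m≤D)) (Σ<-below D m)) ℕₚ.≤-refl

  data Layer : Set where
    full half none : Layer

  score : Layer → ℕ
  score full = 2
  score half = 1
  score none = 0

  data Joined : Layer → Layer → Set where
    fullˡ    : ∀ {b} → Joined full b
    fullʳ    : ∀ {a} → Joined a full
    bothHalf : Joined half half

  -- Half-integral rounding of a fractional vertex cover w / D of a graph: a
  -- threshold t < D rounds w x / D to 1 when 2 w x ≥ 2 D - t, to 0 when
  -- 2 w x ≤ t, and to 1/2 otherwise. The score is twice the rounded value, and
  -- its average over t is at most 2 w x / D.
  module _ {N} (w : Fin N → ℕ) (D : ℕ) where

    layer : ℕ → Fin N → Layer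
    layer t x with D + D ℕₚ.≤? (w x + w x) + t | suc t ℕₚ.≤? (w x + w x)
    ... | yes _ | _     = full
    ... | no  _ | yes _ = half
    ... | no  _ | no  _ = none

    score-layer : ∀ {t} → t < D → ∀ x → score (layer t x) ≤ ⟦ D + D ≤ (w x + w x) + t ⟧ + ⟦ suc t ≤ (w x + w x) ⟧
    score-layer {t} t<D x with D + D ℕₚ.≤? (w x + w x) + t in eq₁ | suc t ℕₚ.≤? (w x + w x) in eq₂
    ... | yes p | yes q rewrite ⟦≤⟧-true p | ⟦≤⟧-true q = ℕₚ.≤-refl
    -- For t < D the cutoffs t and 2 D - t do not cross; otherwise a full vertex would score 2
    -- against a count of 1.
    ... | yes p | no ¬q = contradiction (ℕₚ.+-mono-≤-< (ℕₚ.≮⇒≥ ¬q) t<D) (ℕₚ.≤⇒≯ (ℕₚ.≤-trans (ℕₚ.+-monoˡ-≤ D (ℕₚ.<⇒≤ t<D)) p))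
    ... | no ¬p | yes q rewrite ⟦≤⟧-true q = ℕₚ.m≤n+m 1 _
    ... | no ¬p | no ¬q = z≤n

    -- The cutoffs t and 2 D - t are symmetric about D, and 2 w x + 2 w y ≥ 2 D: when x is rounded
    -- to 0, its neighbour y must be rounded to 1.
    heavy-partner : ∀ {t} x y → D ≤ w x + w y → ¬ (suc t ≤ w x + w x) → D + D ≤ (w y + w y) + t
    heavy-partner {t} x y D≤ x-light = begin
      D + D                     ≤⟨ ℕₚ.+-mono-≤ D≤ D≤ ⟩
      (w x + w y) + (w x + w y) ≡⟨ regroup (w x) (w y) ⟩
      (w y + w y) + (w x + w x) ≤⟨ ℕₚ.+-monoʳ-≤ (w y + w y) (ℕₚ.≮⇒≥ x-light) ⟩
      (w y + w y) + t           ∎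
      where
      open ℕₚ.≤-Reasoning
      regroup : ∀ a b → (a + b) + (a + b) ≡ (b + b) + (a + a)
      regroup = ℕ-Solver.solve-∀

    layer-joined : ∀ t x y → D ≤ w x + w y → Joined (layer t x) (layer t y)
    layer-joined t x y D≤
      with D + D ℕₚ.≤? (w x + w x) + t | suc t ℕₚ.≤? (w x + w x)
         | D + D ℕₚ.≤? (w y + w y) + t | suc t ℕₚ.≤? (w y + w y)
    ... | yes _ | _     | _     | _     = fullˡ
    ... | no _  | _     | yes _ | _     = fullʳ
    ... | no _  | yes _ | no _  | yes _ = bothHalf
    ... | no _  | no q  | no p  | _     = contradiction (heavy-partner x y D≤ q) p
    ... | no p  | yes _ | no _  | no q  =
      contradiction (heavy-partner y x (subst (D ≤_) (ℕₚ.+-comm (w x) (w y)) D≤) q) p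

    round : ∀ s → sum w < (s + 1) * D → ∃ λ (ℓ : Fin N → Layer) →
      sum (score ∘ ℓ) ≤ s + s + 1 × (∀ x y → D ≤ w x + w y → Joined (ℓ x) (ℓ y))
    -- The scores summed over all D thresholds stay below 2 (s + 1) D, so some threshold has score
    -- below 2 s + 2, hence at most 2 s + 1.
    round s small with Σ<-pigeonhole D F (s + s + 2) (begin-strict
        Σ< D F
          ≡⟨ Σ<-sum-comm D (λ x t → ⟦ D + D ≤ (w x + w x) + t ⟧ + ⟦ suc t ≤ (w x + w x) ⟧) ⟩
        sum (λ x → Σ< D (λ t → ⟦ D + D ≤ (w x + w x) + t ⟧ + ⟦ suc t ≤ (w x + w x) ⟧))
          ≤⟨ sum-mono (λ x → thresholdCount D (w x + w x)) ⟩
        sum (λ x → w x + w x)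
          ≡⟨ ∑-distrib-+ w w ⟩
        sum w + sum w
          <⟨ ℕₚ.+-mono-< small small ⟩
        (s + 1) * D + (s + 1) * D
          ≡⟨ regroup s D ⟩
        D * (s + s + 2) ∎)
      where
      open ℕₚ.≤-Reasoning
      F : ℕ → ℕ
      F t = sum (λ x → ⟦ D + D ≤ (w x + w x) + t ⟧ + ⟦ suc t ≤ (w x + w x) ⟧)
      regroup : ∀ s D → (s + 1) * D + (s + 1) * D ≡ D * (s + s + 2)
      regroup = ℕ-Solver.solve-∀
    ... | t , t<D , few = layer t ,
      ℕₚ.≤-pred (ℕₚ.≤-trans (s≤s (sum-mono (score-layer t<D))) (ℕₚ.≤-trans few (ℕₚ.≤-reflexive (ℕₚ.+-suc (s + s) 1)))) ,
      layer-joined t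

  argmin : ∀ {n} (w : Fin (suc n) → ℕ) → ∃ λ v → ∀ u → w v ≤ w u
  argmin {zero}  w = zero , λ { zero → ℕₚ.≤-refl }
  argmin {suc n} w with argmin (w ∘ suc)
  ... | v , min with ℕₚ.≤-total (w zero) (w (suc v))
  ... | inj₁ ≤v = zero , λ { zero → ℕₚ.≤-refl ; (suc u) → ℕₚ.≤-trans ≤v (min u) }
  ... | inj₂ v≤ = suc v , λ { zero → v≤ ; (suc u) → min u }

  weight-insertAt : ∀ {n} (w : Fin (suc n) → ℕ) e v →
    weight w (insertAt e v inside) ≡ w v + weight (w ∘ punchIn v) e
  weight-insertAt w e v = begin
    weight w (insertAt e v inside)
      ≡⟨ sum-remove {i = v} (λ u → 𝟙 (lookup (insertAt e v inside) u) * w u) ⟩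
    𝟙 (lookup (insertAt e v inside) v) * w v + sum (λ x → 𝟙 (lookup (insertAt e v inside) (punchIn v x)) * w (punchIn v x))
      ≡⟨ cong₂ _+_
           (trans (cong (λ b → 𝟙 b * w v) (Vecₚ.insertAt-lookup e v inside)) (ℕₚ.*-identityˡ (w v)))
           (sum-cong-≗ (λ x → cong (λ b → 𝟙 b * w (punchIn v x)) (Vecₚ.insertAt-punchIn e v inside x))) ⟩
    w v + weight (w ∘ punchIn v) e ∎
    where open ≡-Reasoning

  lookup-⁅⁆ : ∀ {n} (x u : Fin n) → 𝟙 (lookup ⁅ x ⁆ u) ≡ δ x u
  lookup-⁅⁆ zero    zero    = refl
  lookup-⁅⁆ zero    (suc u) = cong 𝟙 (Vecₚ.lookup-replicate u outside)
  lookup-⁅⁆ (suc x) zero    = refl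
  lookup-⁅⁆ (suc x) (suc u) = lookup-⁅⁆ x u

  𝟙-∨ : ∀ a b → 𝟙 (a ∨ b) ≤ 𝟙 a + 𝟙 b
  𝟙-∨ true  b = s≤s z≤n
  𝟙-∨ false b = ℕₚ.≤-refl

  -- Only an inequality, so that x = y, where the union is a singleton, needs no separate case.
  weight-pair : ∀ {n} (w : Fin n → ℕ) x y → weight w (⁅ x ⁆ ∪ ⁅ y ⁆) ≤ w x + w y
  weight-pair w x y = begin
    weight w (⁅ x ⁆ ∪ ⁅ y ⁆)
      ≤⟨ sum-mono (λ u → ℕₚ.*-monoˡ-≤ (w u) (indicator u)) ⟩
    sum (λ u → (δ x u + δ y u) * w u)
      ≡⟨ sum-cong-≗ (λ u → regroup (δ x u) (δ y u) (w u)) ⟩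
    sum (λ u → w u * δ x u + w u * δ y u)
      ≡⟨ ∑-distrib-+ (λ u → w u * δ x u) (λ u → w u * δ y u) ⟩
    sum (λ u → w u * δ x u) + sum (λ u → w u * δ y u)
      ≡⟨ cong₂ _+_ (sum-*-δ w x) (sum-*-δ w y) ⟩
    w x + w y ∎
    where
    open ℕₚ.≤-Reasoning
    regroup : ∀ a b c → (a + b) * c ≡ c * a + c * b
    regroup = ℕ-Solver.solve-∀
    indicator : ∀ u → 𝟙 (lookup (⁅ x ⁆ ∪ ⁅ y ⁆) u) ≤ δ x u + δ y u
    indicator u = begin
      𝟙 (lookup (⁅ x ⁆ ∪ ⁅ y ⁆) u)
        ≡⟨ cong 𝟙 (Vecₚ.lookup-zipWith _∨_ u ⁅ x ⁆ ⁅ y ⁆) ⟩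
      𝟙 (lookup ⁅ x ⁆ u ∨ lookup ⁅ y ⁆ u)
        ≤⟨ 𝟙-∨ (lookup ⁅ x ⁆ u) (lookup ⁅ y ⁆ u) ⟩
      𝟙 (lookup ⁅ x ⁆ u) + 𝟙 (lookup ⁅ y ⁆ u)
        ≡⟨ cong₂ _+_ (lookup-⁅⁆ x u) (lookup-⁅⁆ y u) ⟩
      δ x u + δ y u ∎

  LinkLayering : ∀ {N} → SimpleGraph N → ℕ → Set
  LinkLayering {N} G s = ∃ λ (ℓ : Fin N → Layer) →
    sum (score ∘ ℓ) ≤ s + s + 1 × (∀ x y → T (isEdge G (⁅ x ⁆ ∪ ⁅ y ⁆)) → Joined (ℓ x) (ℓ y))

  -- Subtracting the minimal weight μ everywhere and 3 μ from D keeps a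
  -- fractional cover of size below s + 1 because n ≥ 3 (s + 1); then the vertex
  -- of minimal weight contributes nothing to the edges through it.
  link-layering : ∀ {N} s → 3 * s + 3 ≤ suc N → (H : 3-Graph (suc N)) →
    FractionalCover (edges H) (s + 1) → ∃ λ v → LinkLayering (link H v) s
  link-layering {N} s 3s+3≤n H (w , D , covers , small) with argmin w
  ... | v , min = v , proj₁ rounded , proj₁ (proj₂ rounded) , λ x y edge → proj₂ (proj₂ rounded) x y (pair x y edge)
    where
    open ℕₚ.≤-Reasoning
    μ : ℕ
    μ = w v
    w′ : Fin N → ℕ
    w′ x = w (punchIn v x) ∸ μ
    w≡ : ∀ x → w (punchIn v x) ≡ w′ x + μ
    w≡ x = sym (ℕₚ.m∸n+n≡m (min (punchIn v x)))
    total : sum w ≡ sum w′ + suc N * μ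
    total = begin-equality
      sum w                                      ≡⟨ sum-remove {i = v} w ⟩
      μ + sum (λ x → w (punchIn v x))            ≡⟨ cong (_+_ μ) (sum-cong-≗ w≡) ⟩
      μ + sum (λ x → w′ x + μ)                   ≡⟨ cong (_+_ μ) (∑-distrib-+ w′ (λ _ → μ)) ⟩
      μ + (sum w′ + sum {N} (λ _ → μ))           ≡⟨ cong (λ z → μ + (sum w′ + z)) (sum-const N μ) ⟩
      μ + (sum w′ + N * μ)                       ≡⟨ regroup μ (sum w′) (N * μ) ⟩
      sum w′ + suc N * μ                         ∎
      where
      regroup : ∀ a b c → a + (b + c) ≡ b + (a + c)
      regroup = ℕ-Solver.solve-∀
    D′ : ℕ
    D′ = D ∸ 3 * μ
    bound : sum w′ + (s + 1) * (3 * μ) < (s + 1) * D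
    bound = begin-strict
      sum w′ + (s + 1) * (3 * μ) ≡⟨ cong (_+_ (sum w′)) (regroup s μ) ⟩
      sum w′ + (3 * s + 3) * μ   ≤⟨ ℕₚ.+-monoʳ-≤ (sum w′) (ℕₚ.*-monoˡ-≤ μ 3s+3≤n) ⟩
      sum w′ + suc N * μ         ≡⟨ sym total ⟩
      sum w                      <⟨ small ⟩
      (s + 1) * D                ∎
      where
      regroup : ∀ s μ → (s + 1) * (3 * μ) ≡ (3 * s + 3) * μ
      regroup = ℕ-Solver.solve-∀
    -- `D′` is a truncated difference and has to be a true one; `bound` gives (s + 1) (3 μ) < (s +
    -- 1) D.
    3μ≤D : 3 * μ ≤ D
    3μ≤D = ℕₚ.<⇒≤ (ℕₚ.*-cancelˡ-< (s + 1) (3 * μ) D (ℕₚ.≤-<-trans (ℕₚ.m≤n+m _ (sum w′)) bound))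
    small′ : sum w′ < (s + 1) * D′
    small′ = ℕₚ.+-cancelʳ-< ((s + 1) * (3 * μ)) (sum w′) ((s + 1) * D′) (begin-strict
      sum w′ + (s + 1) * (3 * μ)        <⟨ bound ⟩
      (s + 1) * D                       ≡⟨ cong ((s + 1) *_) (sym (ℕₚ.m∸n+n≡m 3μ≤D)) ⟩
      (s + 1) * (D′ + 3 * μ)            ≡⟨ ℕₚ.*-distribˡ-+ (s + 1) D′ (3 * μ) ⟩
      (s + 1) * D′ + (s + 1) * (3 * μ)  ∎)
    rounded = round w′ D′ s small′
    -- A link edge extends by v to an edge of H. Its three vertices lose μ each, which matches the 3
    -- μ taken from D, and v is left with weight 0.
    pair : ∀ x y → T (isEdge (link H v) (⁅ x ⁆ ∪ ⁅ y ⁆)) → D′ ≤ w′ x + w′ y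
    pair x y edge = ℕₚ.+-cancelʳ-≤ (3 * μ) D′ (w′ x + w′ y) (begin
      D′ + 3 * μ
        ≡⟨ ℕₚ.m∸n+n≡m 3μ≤D ⟩
      D
        ≤⟨ covers (∈-filter⁺ (λ e → T? (isEdge H e)) (subsets-complete _) edge) ⟩
      weight w (insertAt (⁅ x ⁆ ∪ ⁅ y ⁆) v inside)
        ≡⟨ weight-insertAt w (⁅ x ⁆ ∪ ⁅ y ⁆) v ⟩
      μ + weight (w ∘ punchIn v) (⁅ x ⁆ ∪ ⁅ y ⁆)
        ≤⟨ ℕₚ.+-monoʳ-≤ μ (weight-pair (w ∘ punchIn v) x y) ⟩
      μ + (w (punchIn v x) + w (punchIn v y))
        ≡⟨ cong₂ (λ a b → μ + (a + b)) (w≡ x) (w≡ y) ⟩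
      μ + ((w′ x + μ) + (w′ y + μ))
        ≡⟨ regroup μ (w′ x) (w′ y) ⟩
      (w′ x + w′ y) + 3 * μ ∎)
      where
      regroup : ∀ μ a b → μ + ((a + μ) + (b + μ)) ≡ (a + b) + 3 * μ
      regroup = ℕ-Solver.solve-∀

module _ where
  open import Data.Rational.Base using (_+_; _*_; _≤_; _<_)
  open ℚSum

  -- Rational arithmetic and finite rational sums.

  /-mono-≤ : ∀ a b k l → a ℕ.* suc l ℕ.≤ b ℕ.* suc k → + a / suc k ≤ + b / suc l
  /-mono-≤ a b k l h = ℚₚ.toℚᵘ-cancel-≤ (begin
    ℚ.toℚᵘ (+ a / suc k)   ≃⟨ ℚₚ.toℚᵘ-fromℚᵘ (ℚᵘ.mkℚᵘ (+ a) k) ⟩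
    ℚᵘ.mkℚᵘ (+ a) k        ≤⟨ ℚᵘ.*≤* (subst₂ ℤ._≤_ (ℤₚ.pos-* a (suc l)) (ℤₚ.pos-* b (suc k)) (ℤ.+≤+ h)) ⟩
    ℚᵘ.mkℚᵘ (+ b) l        ≃⟨ ℚᵘₚ.≃-sym (ℚₚ.toℚᵘ-fromℚᵘ (ℚᵘ.mkℚᵘ (+ b) l)) ⟩
    ℚ.toℚᵘ (+ b / suc l)   ∎)
    where open ℚᵘₚ.≤-Reasoning

  /-homo-+ : ∀ a b k → + (a ℕ.+ b) / suc k ≡ + a / suc k + + b / suc k
  /-homo-+ a b k = ℚₚ.toℚᵘ-injective (begin
    ℚ.toℚᵘ (+ (a ℕ.+ b) / suc k)
      ≈⟨ ℚₚ.toℚᵘ-fromℚᵘ (ℚᵘ.mkℚᵘ (+ (a ℕ.+ b)) k) ⟩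
    ℚᵘ.mkℚᵘ (+ (a ℕ.+ b)) k
      ≈⟨ ℚᵘ.*≡* (trans (cong (ℤ._* + (suc k ℕ.* suc k)) (ℤₚ.pos-+ a b)) (trans (cong ((+ a ℤ.+ + b) ℤ.*_) (ℤₚ.pos-* (suc k) (suc k))) (regroup (+ a) (+ b) (+ suc k)))) ⟩
    ℚᵘ.mkℚᵘ (+ a) k ℚᵘ.+ ℚᵘ.mkℚᵘ (+ b) k
      ≈⟨ ℚᵘₚ.+-cong (ℚₚ.toℚᵘ-fromℚᵘ (ℚᵘ.mkℚᵘ (+ a) k)) (ℚₚ.toℚᵘ-fromℚᵘ (ℚᵘ.mkℚᵘ (+ b) k)) ⟨
    ℚ.toℚᵘ (+ a / suc k) ℚᵘ.+ ℚ.toℚᵘ (+ b / suc k)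
      ≈⟨ ℚₚ.toℚᵘ-homo-+ (+ a / suc k) (+ b / suc k) ⟨
    ℚ.toℚᵘ (+ a / suc k + + b / suc k) ∎)
    where
    open import Relation.Binary.Reasoning.Setoid ℚᵘₚ.≃-setoid
    regroup : ∀ a b c → (a ℤ.+ b) ℤ.* (c ℤ.* c) ≡ (a ℤ.* c ℤ.+ b ℤ.* c) ℤ.* c
    regroup = ℤ-Solver.solve-∀

  /-homo-* : ∀ a b k l → (+ a / suc k) * (+ b / suc l) ≡ + (a ℕ.* b) / (suc k ℕ.* suc l)
  /-homo-* a b k l = ℚₚ.toℚᵘ-injective (begin
    ℚ.toℚᵘ ((+ a / suc k) * (+ b / suc l))
      ≈⟨ ℚₚ.toℚᵘ-homo-* (+ a / suc k) (+ b / suc l) ⟩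
    ℚ.toℚᵘ (+ a / suc k) ℚᵘ.* ℚ.toℚᵘ (+ b / suc l)
      ≈⟨ ℚᵘₚ.*-cong (ℚₚ.toℚᵘ-fromℚᵘ (ℚᵘ.mkℚᵘ (+ a) k)) (ℚₚ.toℚᵘ-fromℚᵘ (ℚᵘ.mkℚᵘ (+ b) l)) ⟩
    ℚᵘ.mkℚᵘ (+ a) k ℚᵘ.* ℚᵘ.mkℚᵘ (+ b) l
      ≈⟨ ℚᵘ.*≡* (cong (ℤ._* + (suc k ℕ.* suc l)) (sym (ℤₚ.pos-* a b))) ⟩
    ℚᵘ.mkℚᵘ (+ (a ℕ.* b)) (l ℕ.+ k ℕ.* suc l)
      ≈⟨ ℚₚ.toℚᵘ-fromℚᵘ (ℚᵘ.mkℚᵘ (+ (a ℕ.* b)) (l ℕ.+ k ℕ.* suc l)) ⟨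
    ℚ.toℚᵘ (+ (a ℕ.* b) / (suc k ℕ.* suc l)) ∎)
    where open import Relation.Binary.Reasoning.Setoid ℚᵘₚ.≃-setoid

  ι : ℕ → ℚ
  ι m = + m / 1

  ι-homo-+ : ∀ a b → ι (a ℕ.+ b) ≡ ι a + ι b
  ι-homo-+ a b = /-homo-+ a b 0

  ι-homo-* : ∀ a b → ι (a ℕ.* b) ≡ ι a * ι b
  ι-homo-* a b = sym (/-homo-* a b 0 0)

  ι-mono-≤ : ∀ {a b} → a ℕ.≤ b → ι a ≤ ι b
  ι-mono-≤ {a} {b} a≤b = /-mono-≤ a b 0 0 (ℕₚ.*-monoˡ-≤ 1 a≤b)

  0≤ι : ∀ a → 0ℚ ≤ ι a
  0≤ι a = ι-mono-≤ (z≤n {a})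

  ι-suc-pos : ∀ a → 0ℚ < ι (suc a)
  ι-suc-pos a = ℚₚ.<-≤-trans (ℚₚ.positive⁻¹ 1ℚ) (ι-mono-≤ (s≤s (z≤n {a})))

  0≤+ : ∀ {p q} → 0ℚ ≤ p → 0ℚ ≤ q → 0ℚ ≤ p + q
  0≤+ = ℚₚ.+-mono-≤

  0≤* : ∀ {p q} → 0ℚ ≤ p → 0ℚ ≤ q → 0ℚ ≤ p * q
  0≤* {p} {q} 0≤p 0≤q = subst (_≤ p * q) (ℚₚ.*-zeroʳ p) (ℚₚ.*-monoˡ-≤-nonNeg p {{ℚ.nonNegative 0≤p}} 0≤q)

  0<* : ∀ {p q} → 0ℚ < p → 0ℚ < q → 0ℚ < p * q
  0<* {p} {q} 0<p 0<q = subst (_< p * q) (ℚₚ.*-zeroʳ p) (ℚₚ.*-monoʳ-<-pos p {{ℚ.positive 0<p}} 0<q)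

  p≤p+q : ∀ {p q} → 0ℚ ≤ q → p ≤ p + q
  p≤p+q {p} {q} 0≤q = subst (_≤ p + q) (ℚₚ.+-identityʳ p) (ℚₚ.+-monoʳ-≤ p 0≤q)

  ≤-from-≡+ : ∀ {p q} r → q ≡ p + r → 0ℚ ≤ r → p ≤ q
  ≤-from-≡+ r refl 0≤r = p≤p+q 0≤r

  p≤q⇒0≤q-p : ∀ {p q} → p ≤ q → 0ℚ ≤ q - p
  p≤q⇒0≤q-p {p} {q} p≤q = subst (_≤ q - p) (ℚₚ.+-inverseʳ p) (ℚₚ.+-monoˡ-≤ (ℚ.- p) p≤q)

  p≤∣p∣ : ∀ p → p ≤ ℚ.∣ p ∣
  p≤∣p∣ p with ℚₚ.≤-total 0ℚ p
  ... | inj₁ 0≤p = ℚₚ.≤-reflexive (sym (ℚₚ.0≤p⇒∣p∣≡p 0≤p))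
  ... | inj₂ p≤0 = ℚₚ.≤-trans p≤0 (ℚₚ.0≤∣p∣ p)

  +-cancelˡ-≤ : ∀ r {p q} → r + p ≤ r + q → p ≤ q
  +-cancelˡ-≤ r {p} {q} h = subst₂ _≤_ (cancel p) (cancel q) (ℚₚ.+-monoʳ-≤ (ℚ.- r) h)
    where
    cancel : ∀ x → ℚ.- r + (r + x) ≡ x
    cancel x = trans (sym (ℚₚ.+-assoc (ℚ.- r) r x)) (trans (cong (_+ x) (ℚₚ.+-inverseˡ r)) (ℚₚ.+-identityˡ x))

  sumℚ-mono : ∀ {n} {f g : Fin n → ℚ} → (∀ i → f i ≤ g i) → sum f ≤ sum g
  sumℚ-mono {zero}  f≤g = ℚₚ.≤-refl
  sumℚ-mono {suc n} f≤g = ℚₚ.+-mono-≤ (f≤g zero) (sumℚ-mono (f≤g ∘ suc))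

  sumℚ-nonneg : ∀ {n} {f : Fin n → ℚ} → (∀ i → 0ℚ ≤ f i) → 0ℚ ≤ sum f
  sumℚ-nonneg {zero}  0≤f = ℚₚ.≤-refl
  sumℚ-nonneg {suc n} 0≤f = 0≤+ (0≤f zero) (sumℚ-nonneg (0≤f ∘ suc))

  term≤sum : ∀ {n} {f : Fin n → ℚ} → (∀ i → 0ℚ ≤ f i) → ∀ i → f i ≤ sum f
  term≤sum {f = f} 0≤f zero = p≤p+q (sumℚ-nonneg (0≤f ∘ suc))
  term≤sum {f = f} 0≤f (suc i) = ℚₚ.≤-trans (term≤sum (0≤f ∘ suc) i)
    (subst (_≤ f zero + sum (f ∘ suc)) (ℚₚ.+-identityˡ _) (ℚₚ.+-monoˡ-≤ (sum (f ∘ suc)) (0≤f zero)))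

  ∣sum∣≤sum∣∣ : ∀ {n} (f : Fin n → ℚ) → ℚ.∣ sum f ∣ ≤ sum (λ i → ℚ.∣ f i ∣)
  ∣sum∣≤sum∣∣ {zero}  f = ℚₚ.≤-refl
  ∣sum∣≤sum∣∣ {suc n} f = ℚₚ.≤-trans (ℚₚ.∣p+q∣≤∣p∣+∣q∣ (f zero) (sum (f ∘ suc)))
    (ℚₚ.+-monoʳ-≤ ℚ.∣ f zero ∣ (∣sum∣≤sum∣∣ (f ∘ suc)))

  -- Accounts for the zero diagonal of the adjacency matrix: a vertex counted in its own layer is
  -- not its own neighbour.
  sum-omitting : ∀ {n} (h g : Fin n → ℚ) → (∀ j → h j ≤ g j) → ∀ i → h i ≡ 0ℚ → sum h + g i ≤ sum g
  sum-omitting h g h≤g zero h≡0 rewrite h≡0 = begin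
    0ℚ + sum (h ∘ suc) + g zero ≡⟨ cong (_+ g zero) (ℚₚ.+-identityˡ (sum (h ∘ suc))) ⟩
    sum (h ∘ suc) + g zero      ≡⟨ ℚₚ.+-comm (sum (h ∘ suc)) (g zero) ⟩
    g zero + sum (h ∘ suc)      ≤⟨ ℚₚ.+-monoʳ-≤ (g zero) (sumℚ-mono (h≤g ∘ suc)) ⟩
    g zero + sum (g ∘ suc)      ∎
    where open ℚₚ.≤-Reasoning
  sum-omitting h g h≤g (suc i) h≡0 = begin
    h zero + sum (h ∘ suc) + g (suc i)   ≡⟨ ℚₚ.+-assoc (h zero) (sum (h ∘ suc)) (g (suc i)) ⟩
    h zero + (sum (h ∘ suc) + g (suc i)) ≤⟨ ℚₚ.+-mono-≤ (h≤g zero) (sum-omitting (h ∘ suc) (g ∘ suc) (h≤g ∘ suc) i h≡0) ⟩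
    g zero + sum (g ∘ suc)               ∎
    where open ℚₚ.≤-Reasoning

  -- Approximate eigenvectors

  -- Pairing A z with the test vector y: by the symmetry of A,
  -- (θ + ε) ⟨y , |z|⟩ ≤ ⟨y , A |z|⟩ + δ Σ y = ⟨A y , |z|⟩ + δ Σ y ≤ θ ⟨y , |z|⟩ + δ Σ y.
  approximate-eigenvector : ∀ {N} (A : Fin N → Fin N → ℚ) →
    (∀ i j → A i j ≡ A j i) → (∀ i j → 0ℚ ≤ A i j) →
    (y z : Fin N → ℚ) → (∀ i → 0ℚ ≤ y i) →
    ∀ {θ ε δ r} → 0ℚ ≤ θ → 0ℚ ≤ ε → (∀ i → sum (λ j → A i j * y j) ≤ θ * y i) → θ + ε ≤ r →
    (∀ i → ℚ.∣ sum (λ j → A i j * z j) - r * z i ∣ ≤ δ) →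
    ε * sum (λ i → y i * ℚ.∣ z i ∣) ≤ δ * sum y
  approximate-eigenvector A A-sym 0≤A y z 0≤y {θ} {ε} {δ} {r} 0≤θ 0≤ε Ay≤θy θ+ε≤r approx =
    +-cancelˡ-≤ (θ * W) (begin
      θ * W + ε * W
        ≡⟨ sym (ℚₚ.*-distribʳ-+ W θ ε) ⟩
      (θ + ε) * W
        ≡⟨ *-distribˡ-sum (θ + ε) (λ i → y i * ℚ.∣ z i ∣) ⟩
      sum (λ i → (θ + ε) * (y i * ℚ.∣ z i ∣))
        ≤⟨ sumℚ-mono pointwise ⟩
      sum (λ i → sum (λ j → y i * (A i j * ℚ.∣ z j ∣)) + δ * y i)
        ≡⟨ ∑-distrib-+ (λ i → sum (λ j → y i * (A i j * ℚ.∣ z j ∣))) (λ i → δ * y i) ⟩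
      sum (λ i → sum (λ j → y i * (A i j * ℚ.∣ z j ∣))) + sum (λ i → δ * y i)
        ≡⟨ cong₂ _+_ (∑-comm (λ i j → y i * (A i j * ℚ.∣ z j ∣))) (sym (*-distribˡ-sum δ y)) ⟩
      sum (λ j → sum (λ i → y i * (A i j * ℚ.∣ z j ∣))) + δ * sum y
        ≤⟨ ℚₚ.+-monoˡ-≤ (δ * sum y) (sumℚ-mono column) ⟩
      sum (λ j → θ * (y j * ℚ.∣ z j ∣)) + δ * sum y
        ≡⟨ cong (_+ δ * sum y) (sym (*-distribˡ-sum θ (λ j → y j * ℚ.∣ z j ∣))) ⟩
      θ * W + δ * sum y ∎)
    where
    open ℚₚ.≤-Reasoning
    open +-*-Solver using (solve; _:+_; _:-_; _:*_; _:=_)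
    W = sum (λ i → y i * ℚ.∣ z i ∣)
    0≤r : 0ℚ ≤ r
    0≤r = ℚₚ.≤-trans (0≤+ 0≤θ 0≤ε) θ+ε≤r
    modulus : ∀ i → (θ + ε) * ℚ.∣ z i ∣ ≤ sum (λ j → A i j * ℚ.∣ z j ∣) + δ
    modulus i = begin
      (θ + ε) * ℚ.∣ z i ∣
        ≤⟨ ℚₚ.*-monoʳ-≤-nonNeg ℚ.∣ z i ∣ {{ℚₚ.∣-∣-nonNeg (z i)}} θ+ε≤r ⟩
      r * ℚ.∣ z i ∣
        ≡⟨ cong (_* ℚ.∣ z i ∣) (sym (ℚₚ.0≤p⇒∣p∣≡p 0≤r)) ⟩
      ℚ.∣ r ∣ * ℚ.∣ z i ∣
        ≡⟨ sym (ℚₚ.∣p*q∣≡∣p∣*∣q∣ r (z i)) ⟩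
      ℚ.∣ r * z i ∣
        ≡⟨ cong ℚ.∣_∣ (solve 2 (λ a b → b := a :- (a :- b)) refl (sum (λ j → A i j * z j)) (r * z i)) ⟩
      ℚ.∣ sum (λ j → A i j * z j) - (sum (λ j → A i j * z j) - r * z i) ∣
        ≤⟨ ℚₚ.∣p-q∣≤∣p∣+∣q∣ (sum (λ j → A i j * z j)) (sum (λ j → A i j * z j) - r * z i) ⟩
      ℚ.∣ sum (λ j → A i j * z j) ∣ + ℚ.∣ sum (λ j → A i j * z j) - r * z i ∣
        ≤⟨ ℚₚ.+-mono-≤ (∣sum∣≤sum∣∣ (λ j → A i j * z j)) (approx i) ⟩
      sum (λ j → ℚ.∣ A i j * z j ∣) + δ
        ≡⟨ cong (_+ δ) (sum-cong-≗ (λ j → trans (ℚₚ.∣p*q∣≡∣p∣*∣q∣ (A i j) (z j)) (cong (_* ℚ.∣ z j ∣) (ℚₚ.0≤p⇒∣p∣≡p (0≤A i j))))) ⟩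
      sum (λ j → A i j * ℚ.∣ z j ∣) + δ ∎
    pointwise : ∀ i → (θ + ε) * (y i * ℚ.∣ z i ∣) ≤ sum (λ j → y i * (A i j * ℚ.∣ z j ∣)) + δ * y i
    pointwise i = begin
      (θ + ε) * (y i * ℚ.∣ z i ∣)
        ≡⟨ solve 3 (λ t y z → t :* (y :* z) := y :* (t :* z)) refl (θ + ε) (y i) ℚ.∣ z i ∣ ⟩
      y i * ((θ + ε) * ℚ.∣ z i ∣)
        ≤⟨ ℚₚ.*-monoˡ-≤-nonNeg (y i) {{ℚ.nonNegative (0≤y i)}} (modulus i) ⟩
      y i * (sum (λ j → A i j * ℚ.∣ z j ∣) + δ)
        ≡⟨ solve 3 (λ y s d → y :* (s :+ d) := y :* s :+ d :* y) refl (y i) (sum (λ j → A i j * ℚ.∣ z j ∣)) δ ⟩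
      y i * sum (λ j → A i j * ℚ.∣ z j ∣) + δ * y i
        ≡⟨ cong (_+ δ * y i) (*-distribˡ-sum (y i) (λ j → A i j * ℚ.∣ z j ∣)) ⟩
      sum (λ j → y i * (A i j * ℚ.∣ z j ∣)) + δ * y i ∎
    column : ∀ j → sum (λ i → y i * (A i j * ℚ.∣ z j ∣)) ≤ θ * (y j * ℚ.∣ z j ∣)
    column j = begin
      sum (λ i → y i * (A i j * ℚ.∣ z j ∣))
        ≡⟨ sum-cong-≗ (λ i → trans
             (solve 3 (λ y a z → y :* (a :* z) := (a :* y) :* z) refl (y i) (A i j) ℚ.∣ z j ∣)
             (cong (λ a → a * y i * ℚ.∣ z j ∣) (A-sym i j))) ⟩
      sum (λ i → A j i * y i * ℚ.∣ z j ∣)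
        ≡⟨ sym (*-distribʳ-sum ℚ.∣ z j ∣ (λ i → A j i * y i)) ⟩
      sum (λ i → A j i * y i) * ℚ.∣ z j ∣
        ≤⟨ ℚₚ.*-monoʳ-≤-nonNeg ℚ.∣ z j ∣ {{ℚₚ.∣-∣-nonNeg (z j)}} (Ay≤θy j) ⟩
      θ * y j * ℚ.∣ z j ∣
        ≡⟨ ℚₚ.*-assoc θ (y j) ℚ.∣ z j ∣ ⟩
      θ * (y j * ℚ.∣ z j ∣) ∎

  adjacent : ∀ {N} → SimpleGraph N → Fin N → Fin N → Bool
  adjacent G i j = isEdge G (⁅ i ⁆ ∪ ⁅ j ⁆)

  adjacencyℚ : ∀ {N} → SimpleGraph N → Fin N → Fin N → ℚ
  adjacencyℚ G i j = if adjacent G i j then 1ℚ else 0ℚ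

  adjacencyℚ-sym : ∀ {N} (G : SimpleGraph N) i j → adjacencyℚ G i j ≡ adjacencyℚ G j i
  adjacencyℚ-sym G i j = cong (λ e → if isEdge G e then 1ℚ else 0ℚ) (Subsetₚ.∪-comm ⁅ i ⁆ ⁅ j ⁆)

  0≤adjacencyℚ : ∀ {N} (G : SimpleGraph N) i j → 0ℚ ≤ adjacencyℚ G i j
  0≤adjacencyℚ G i j with adjacent G i j
  ... | true  = ℚₚ.<⇒≤ (ℚₚ.positive⁻¹ 1ℚ)
  ... | false = ℚₚ.≤-refl

  adjacencyℚ-irrefl : ∀ {N} (G : SimpleGraph N) i → adjacencyℚ G i i ≡ 0ℚ
  adjacencyℚ-irrefl G i with adjacent G i i in eq
  ... | false = refl
  ... | true  = contradiction (trans (sym (uniform G (⁅ i ⁆ ∪ ⁅ i ⁆) (subst T (sym eq) tt)))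
                  (trans (cong ∣_∣ (Subsetₚ.∪-idem ⁅ i ⁆)) (Subsetₚ.∣⁅x⁆∣≡1 i))) λ ()

  seq-adjacencyMatrix : ∀ {N} (G : SimpleGraph N) i j k → seq (adjacencyMatrix G i j) k ≡ adjacencyℚ G i j
  seq-adjacencyMatrix G i j k with isEdge G (⁅ i ⁆ ∪ ⁅ j ⁆)
  ... | true  = refl
  ... | false = refl

  seq-sumFin : ∀ {n} (f : Fin n → ℝ) k → seq (sumFin f) k ≡ sum (λ i → seq (f i) k)
  seq-sumFin {zero}  f k = refl
  seq-sumFin {suc n} f k = cong (_+_ (seq (f zero) k)) (seq-sumFin (f ∘ suc) k)

  eventually-∀ : ∀ {n} {P : Fin n → ℕ → Set} → (∀ i → ∃ λ K → ∀ k → K ℕ.≤ k → P i k) →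
    ∃ λ K → ∀ k → K ℕ.≤ k → ∀ i → P i k
  eventually-∀ {zero}  _ = 0 , λ _ _ ()
  eventually-∀ {suc n} e with e zero | eventually-∀ (e ∘ suc)
  ... | K , p | K′ , q = K ℕ.⊔ K′ , λ k ≤k → λ
    { zero → p k (ℕₚ.m⊔n≤o⇒m≤o K K′ ≤k) ; (suc i) → q k (ℕₚ.m⊔n≤o⇒n≤o K K′ ≤k) i }

  -- Apartness carries a rational gap; it keeps the late terms of an eigenvector uniformly away from
  -- zero.
  #0⇒∣∣-bounded-below : ∀ x → x # 0ℝ → ∃ λ η → 0ℚ < η × ∃ λ K → ∀ k → K ℕ.≤ k → η ≤ ℚ.∣ seq x k ∣
  #0⇒∣∣-bounded-below x (inj₁ (η , 0<η , K , h)) = η , 0<η , K , λ k K≤k → begin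
    η                         ≡⟨ solve 2 (λ a b → b := (a :+ b) :+ :- a) refl (seq x k) η ⟩
    seq x k + η + ℚ.- seq x k ≤⟨ ℚₚ.+-monoˡ-≤ (ℚ.- seq x k) (h k K≤k) ⟩
    0ℚ + ℚ.- seq x k          ≡⟨ ℚₚ.+-identityˡ (ℚ.- seq x k) ⟩
    ℚ.- seq x k               ≤⟨ p≤∣p∣ (ℚ.- seq x k) ⟩
    ℚ.∣ ℚ.- seq x k ∣         ≡⟨ ℚₚ.∣-p∣≡∣p∣ (seq x k) ⟩
    ℚ.∣ seq x k ∣             ∎
    where
    open ℚₚ.≤-Reasoning
    open +-*-Solver using (solve; _:+_; :-_; _:=_)
  #0⇒∣∣-bounded-below x (inj₂ (η , 0<η , K , h)) = η , 0<η , K , λ k K≤k → begin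
    η               ≡⟨ sym (ℚₚ.+-identityˡ η) ⟩
    0ℚ + η          ≤⟨ h k K≤k ⟩
    seq x k         ≡⟨ sym (ℚₚ.0≤p⇒∣p∣≡p (ℚₚ.≤-trans (ℚₚ.<⇒≤ 0<η) (ℚₚ.≤-trans (ℚₚ.≤-reflexive (sym (ℚₚ.+-identityˡ η))) (h k K≤k)))) ⟩
    ℚ.∣ seq x k ∣   ∎
    where open ℚₚ.≤-Reasoning

  -- The witness c / (Y + 1) avoids division by a possibly zero Y.
  small-multiplier : ∀ {c Y} → 0ℚ < c → 0ℚ ≤ Y → ∃ λ δ → 0ℚ < δ × δ * Y < c
  small-multiplier {c} {Y} 0<c 0≤Y = c * r , 0<δ , (begin-strict
      c * r * Y        <⟨ ℚₚ.*-monoʳ-<-pos (c * r) {{ℚ.positive 0<δ}}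
                            (subst (_< Y + 1ℚ) (ℚₚ.+-identityʳ Y) (ℚₚ.+-monoʳ-< Y (ℚₚ.positive⁻¹ 1ℚ))) ⟩
      c * r * (Y + 1ℚ) ≡⟨ ℚₚ.*-assoc c r (Y + 1ℚ) ⟩
      c * (r * (Y + 1ℚ)) ≡⟨ cong (c *_) (ℚₚ.*-inverseˡ (Y + 1ℚ)) ⟩
      c * 1ℚ           ≡⟨ ℚₚ.*-identityʳ c ⟩
      c                ∎)
    where
    open ℚₚ.≤-Reasoning
    instance
      Y+1-pos : ℚ.Positive (Y + 1ℚ)
      Y+1-pos = ℚ.positive (ℚₚ.+-mono-≤-< 0≤Y (ℚₚ.positive⁻¹ 1ℚ))
      Y+1-nonZero : ℚ.NonZero (Y + 1ℚ)
      Y+1-nonZero = ℚₚ.pos⇒nonZero (Y + 1ℚ)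
    r : ℚ
    r = ℚ.1/ (Y + 1ℚ)
    0<δ : 0ℚ < c * r
    0<δ = 0<* 0<c (ℚₚ.positive⁻¹ r {{ℚₚ.1/pos⇒pos (Y + 1ℚ)}})

  -- If ρ exceeded θ by ε, then at one late index k the terms z of the eigenvector would satisfy the
  -- eigenvalue equation up to an error δ′, and the pairing with y would give ε y(i₀) η ≤ δ′ Σ y.
  -- The error δ′ is chosen to make this false.
  eigenvalue-bound : ∀ {N} (G : SimpleGraph N) (y : Fin N → ℚ) → (∀ i → 0ℚ < y i) → ∀ θ → 0ℚ ≤ θ →
    (∀ i → sum (λ j → adjacencyℚ G i j * y j) ≤ θ * y i) →
    ∀ ρ → IsEigenvalue (adjacencyMatrix G) ρ → ρ ≤ℝ fromℚ θ
  eigenvalue-bound {N} G y 0<y θ 0≤θ Ay≤θy ρ (x , (i₀ , x#0) , eigen) (ε , 0<ε , K₁ , gap) =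
    ℚₚ.<-irrefl refl (ℚₚ.≤-<-trans (ℚₚ.≤-trans lower upper) δ′Y<c)
    where
    0≤y : ∀ i → 0ℚ ≤ y i
    0≤y i = ℚₚ.<⇒≤ (0<y i)
    away = #0⇒∣∣-bounded-below (x i₀) x#0
    η = proj₁ away
    K₂ = proj₁ (proj₂ (proj₂ away))
    multiplier = small-multiplier {ε * (y i₀ * η)} {sum y} (0<* 0<ε (0<* (0<y i₀) (proj₁ (proj₂ away)))) (sumℚ-nonneg 0≤y)
    δ′ = proj₁ multiplier
    δ′Y<c = proj₂ (proj₂ multiplier)
    late = eventually-∀ (λ i → eigen i δ′ (proj₁ (proj₂ multiplier)))
    K₃ = proj₁ late
    k : ℕ
    k = K₁ ℕ.⊔ K₂ ℕ.⊔ K₃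
    K₁≤k : K₁ ℕ.≤ k
    K₁≤k = ℕₚ.≤-trans (ℕₚ.m≤m⊔n K₁ K₂) (ℕₚ.m≤m⊔n (K₁ ℕ.⊔ K₂) K₃)
    K₂≤k : K₂ ℕ.≤ k
    K₂≤k = ℕₚ.≤-trans (ℕₚ.m≤n⊔m K₁ K₂) (ℕₚ.m≤m⊔n (K₁ ℕ.⊔ K₂) K₃)
    z : Fin N → ℚ
    z i = seq (x i) k
    lower : ε * (y i₀ * η) ≤ ε * sum (λ i → y i * ℚ.∣ z i ∣)
    lower = ℚₚ.*-monoˡ-≤-nonNeg ε {{ℚ.nonNegative (ℚₚ.<⇒≤ 0<ε)}} (ℚₚ.≤-trans
      (ℚₚ.*-monoˡ-≤-nonNeg (y i₀) {{ℚ.nonNegative (0≤y i₀)}} (proj₂ (proj₂ (proj₂ away)) k K₂≤k))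
      (term≤sum {f = λ i → y i * ℚ.∣ z i ∣} (λ i → 0≤* (0≤y i) (ℚₚ.0≤∣p∣ (z i))) i₀))
    approx : ∀ i → ℚ.∣ sum (λ j → adjacencyℚ G i j * z j) - seq ρ k * z i ∣ ≤ δ′
    approx i = subst (λ a → ℚ.∣ a - seq ρ k * z i ∣ ≤ δ′)
      (trans (seq-sumFin (λ j → adjacencyMatrix G i j *ℝ x j) k)
        (sum-cong-≗ (λ j → cong (_* z j) (seq-adjacencyMatrix G i j k))))
      (proj₂ late k (ℕₚ.m≤n⊔m (K₁ ℕ.⊔ K₂) K₃) i)
    upper : ε * sum (λ i → y i * ℚ.∣ z i ∣) ≤ δ′ * sum y
    upper = approximate-eigenvector (adjacencyℚ G) (adjacencyℚ-sym G) (0≤adjacencyℚ G) y z 0≤y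
      0≤θ (ℚₚ.<⇒≤ 0<ε) Ay≤θy (gap k K₁≤k) approx

  -- The test vector

  onLayer : {A : Set} → A → A → A → Layer → A
  onLayer p q r full = p
  onLayer p q r half = q
  onLayer p q r none = r

  -- The sizes are chosen before p, q, r, so one count also evaluates the rows of `reach`, where
  -- some of these values are replaced by 0.
  tally : ∀ {N} (ℓ : Fin N → Layer) → ∃₂ λ a b → ∃ λ c →
    (a ℕ.+ b ℕ.+ c ≡ N) × (a ℕ.+ a ℕ.+ b ≡ ℕSum.sum (score ∘ ℓ)) ×
    (∀ p q r → sum (onLayer p q r ∘ ℓ) ≡ ι a * p + ι b * q + ι c * r)
  tally {zero} ℓ = 0 , 0 , 0 , refl , refl , λ p q r →
    sym (cong₂ _+_ (cong₂ _+_ (ℚₚ.*-zeroˡ p) (ℚₚ.*-zeroˡ q)) (ℚₚ.*-zeroˡ r))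
  tally {suc N} ℓ with ℓ zero | tally (ℓ ∘ suc)
  ... | full | a , b , c , size , score≡ , total = suc a , b , c , cong suc size ,
        trans (cong (λ z → suc z ℕ.+ b) (ℕₚ.+-suc a a)) (cong (2 ℕ.+_) score≡) , λ p q r →
        trans (cong (_+_ p) (total p q r)) (trans (regroup (ι a) (ι b) (ι c) p q r) (cong (λ z → z * p + ι b * q + ι c * r) (sym (ι-homo-+ 1 a))))
    where
    open +-*-Solver using (solve; con; _:+_; _:*_; _:=_)
    regroup : ∀ a b c p q r → p + (a * p + b * q + c * r) ≡ (1ℚ + a) * p + b * q + c * r
    regroup = solve 6 (λ a b c p q r → p :+ (a :* p :+ b :* q :+ c :* r) := (con 1ℚ :+ a) :* p :+ b :* q :+ c :* r) refl
  ... | half | a , b , c , size , score≡ , total = a , suc b , c ,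
        trans (cong (ℕ._+ c) (ℕₚ.+-suc a b)) (cong suc size) ,
        trans (ℕₚ.+-suc (a ℕ.+ a) b) (cong suc score≡) , λ p q r →
        trans (cong (_+_ q) (total p q r)) (trans (regroup (ι a) (ι b) (ι c) p q r) (cong (λ z → ι a * p + z * q + ι c * r) (sym (ι-homo-+ 1 b))))
    where
    open +-*-Solver using (solve; con; _:+_; _:*_; _:=_)
    regroup : ∀ a b c p q r → q + (a * p + b * q + c * r) ≡ a * p + (1ℚ + b) * q + c * r
    regroup = solve 6 (λ a b c p q r → q :+ (a :* p :+ b :* q :+ c :* r) := a :* p :+ (con 1ℚ :+ b) :* q :+ c :* r) refl
  ... | none | a , b , c , size , score≡ , total = a , b , suc c ,
        trans (ℕₚ.+-suc (a ℕ.+ b) c) (cong suc size) , score≡ , λ p q r →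
        trans (cong (_+_ r) (total p q r)) (trans (regroup (ι a) (ι b) (ι c) p q r) (cong (λ z → ι a * p + ι b * q + z * r) (sym (ι-homo-+ 1 c))))
    where
    open +-*-Solver using (solve; con; _:+_; _:*_; _:=_)
    regroup : ∀ a b c p q r → r + (a * p + b * q + c * r) ≡ a * p + b * q + (1ℚ + c) * r
    regroup = solve 6 (λ a b c p q r → r :+ (a :* p :+ b :* q :+ c :* r) := a :* p :+ b :* q :+ (con 1ℚ :+ c) :* r) refl

  -- The inequalities A y ≤ θ y for the densest graph compatible with the layers. The factor θ + 1
  -- in the full and half rows pays for counting the vertex itself; a vertex of the layer none is
  -- not counted in its own row.
  record LayerWeights (a b c : ℕ) (θ : ℚ) : Set where
    field
      p q r   : ℚ
      0<p     : 0ℚ < p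
      0<q     : 0ℚ < q
      0<r     : 0ℚ < r
      fullRow : ι a * p + ι b * q + ι c * r ≤ (θ + 1ℚ) * p
      halfRow : ι a * p + ι b * q ≤ (θ + 1ℚ) * q
      noneRow : ι a * p ≤ θ * r

  -- The contribution to a row of A y in the graph having all edges that `Joined` permits, loops
  -- included.
  reach : ℚ → ℚ → ℚ → Layer → Layer → ℚ
  reach p q r full = onLayer p q r
  reach p q r half = onLayer p q 0ℚ
  reach p q r none = onLayer p 0ℚ 0ℚ

  test-vector : ∀ {N} (G : SimpleGraph N) (ℓ : Fin N → Layer) →
    (∀ x y → T (isEdge G (⁅ x ⁆ ∪ ⁅ y ⁆)) → Joined (ℓ x) (ℓ y)) →
    ∀ {a b c θ} → (∀ p q r → sum (onLayer p q r ∘ ℓ) ≡ ι a * p + ι b * q + ι c * r) →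
    LayerWeights a b c θ →
    ∃ λ (y : Fin N → ℚ) → (∀ i → 0ℚ < y i) × (∀ i → sum (λ j → adjacencyℚ G i j * y j) ≤ θ * y i)
  test-vector {N} G ℓ joined {a} {b} {c} {θ} total W = y , (λ i → 0<val (ℓ i)) , λ i → row i (ℓ i) refl
    where
    open LayerWeights W
    open ℚₚ.≤-Reasoning
    val : Layer → ℚ
    val = onLayer p q r
    y : Fin N → ℚ
    y i = val (ℓ i)
    0<val : ∀ l → 0ℚ < val l
    0<val full = 0<p
    0<val half = 0<q
    0<val none = 0<r
    0≤reach : ∀ l l′ → 0ℚ ≤ reach p q r l l′
    0≤reach full l′   = ℚₚ.<⇒≤ (0<val l′)
    0≤reach half full = ℚₚ.<⇒≤ 0<p
    0≤reach half half = ℚₚ.<⇒≤ 0<q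
    0≤reach half none = ℚₚ.≤-refl
    0≤reach none full = ℚₚ.<⇒≤ 0<p
    0≤reach none half = ℚₚ.≤-refl
    0≤reach none none = ℚₚ.≤-refl
    val≡reach : ∀ {l l′} → Joined l l′ → val l′ ≡ reach p q r l l′
    val≡reach {full} {l′} _ = refl
    val≡reach {half} fullʳ = refl
    val≡reach {none} fullʳ = refl
    val≡reach bothHalf = refl
    entry : ∀ i j → adjacencyℚ G i j * y j ≤ reach p q r (ℓ i) (ℓ j)
    entry i j with isEdge G (⁅ i ⁆ ∪ ⁅ j ⁆) in eq
    ... | true  = ℚₚ.≤-reflexive (trans (ℚₚ.*-identityˡ (y j)) (val≡reach (joined i j (subst T (sym eq) tt))))
    ... | false = ℚₚ.≤-trans (ℚₚ.≤-reflexive (ℚₚ.*-zeroˡ (y j))) (0≤reach (ℓ i) (ℓ j))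
    rowSum : ∀ i → sum (λ j → adjacencyℚ G i j * y j) + reach p q r (ℓ i) (ℓ i) ≤ sum (λ j → reach p q r (ℓ i) (ℓ j))
    rowSum i = sum-omitting (λ j → adjacencyℚ G i j * y j) (λ j → reach p q r (ℓ i) (ℓ j)) (entry i) i
      (trans (cong (_* y i) (adjacencyℚ-irrefl G i)) (ℚₚ.*-zeroˡ (y i)))
    drop-0 : ∀ x z → x + z * 0ℚ ≡ x
    drop-0 x z = trans (cong (_+_ x) (ℚₚ.*-zeroʳ z)) (ℚₚ.+-identityʳ x)
    cancel-own : ∀ x w → x + w ≤ (θ + 1ℚ) * w → x ≤ θ * w
    cancel-own x w h = +-cancelˡ-≤ w (subst₂ _≤_ (ℚₚ.+-comm x w)
      (trans (ℚₚ.*-distribʳ-+ w θ 1ℚ) (trans (cong (_+_ (θ * w)) (ℚₚ.*-identityˡ w)) (ℚₚ.+-comm (θ * w) w))) h)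
    row : ∀ i l → ℓ i ≡ l → sum (λ j → adjacencyℚ G i j * y j) ≤ θ * y i
    row i l eq with rowSum i
    row i l eq | h rewrite eq with l
    ... | full = cancel-own _ p (ℚₚ.≤-trans h (ℚₚ.≤-trans (ℚₚ.≤-reflexive (total p q r)) fullRow))
    ... | half = cancel-own _ q (ℚₚ.≤-trans h (ℚₚ.≤-trans (ℚₚ.≤-reflexive (trans (total p q 0ℚ) (drop-0 (ι a * p + ι b * q) (ι c)))) halfRow))
    ... | none = ℚₚ.≤-trans (ℚₚ.≤-reflexive (sym (ℚₚ.+-identityʳ _))) (ℚₚ.≤-trans h (ℚₚ.≤-trans (ℚₚ.≤-reflexive
        (trans (total p 0ℚ 0ℚ) (trans (drop-0 (ι a * p + ι b * 0ℚ) (ι c)) (drop-0 (ι a * p) (ι b))))) noneRow))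

  -- For M = n - s - 1, the nonnegative θ satisfying this are those bounding the
  -- positive root (s - 1 + √((s - 1)² + 4 s M)) / 2 of θ² - (s - 1) θ - s M.
  AboveThreshold : ℕ → ℕ → ℚ → Set
  AboveThreshold s M θ = 0ℚ ≤ θ × ι s * θ + ι s * ι M ≤ θ * θ + θ

  -- The right side minus the left side of the hypothesis equals - (2 S - θ) (θ + S + 1) - S m,
  -- which is negative when θ < 2 S.
  2s≤θ : ∀ S m θ → 0ℚ ≤ S → 0ℚ ≤ m → 0ℚ ≤ θ → S * θ + S * (S + S + (1ℚ + 1ℚ) + m) ≤ θ * θ + θ → S + S ≤ θ
  2s≤θ S m θ 0≤S 0≤m 0≤θ above = ℚₚ.≮⇒≥ λ θ<2S → ℚₚ.<-irrefl refl (begin-strict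
    θ * θ + θ
      ≡⟨ sym (ℚₚ.+-identityʳ (θ * θ + θ)) ⟩
    θ * θ + θ + 0ℚ
      <⟨ ℚₚ.+-monoʳ-< (θ * θ + θ) (0<* (subst (_< S + S - θ) (ℚₚ.+-inverseʳ θ) (ℚₚ.+-monoˡ-< (ℚ.- θ) θ<2S))
           (ℚₚ.+-mono-≤-< (0≤+ 0≤θ 0≤S) (ℚₚ.positive⁻¹ 1ℚ))) ⟩
    θ * θ + θ + (S + S - θ) * (θ + S + 1ℚ)
      ≤⟨ p≤p+q (0≤* 0≤S 0≤m) ⟩
    θ * θ + θ + (S + S - θ) * (θ + S + 1ℚ) + S * m
      ≡⟨ solve 3 (λ S m θ → θ :* θ :+ θ :+ (S :+ S :- θ) :* (θ :+ S :+ con 1ℚ) :+ S :* m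
           := S :* θ :+ S :* (S :+ S :+ (con 1ℚ :+ con 1ℚ) :+ m)) refl S m θ ⟩
    S * θ + S * (S + S + (1ℚ + 1ℚ) + m)
      ≤⟨ above ⟩
    θ * θ + θ ∎)
    where
    open ℚₚ.≤-Reasoning
    open +-*-Solver using (solve; con; _:+_; _:-_; _:*_; _:=_)

  -- Here θ = 2 s + t, s = a + k, and n - s - 1 = 2 s + 2 + m; the sizes
  -- b₀ = 2 k + 1 and c₀ = 2 a + k + 1 + m are those of the extremal layering
  -- with a full vertices.
  module ExtremalWeights (a k m t : ℚ) where

    -- Up to scale the weights are forced by equality in the half and none rows at the extremal
    -- sizes: r = a p / θ and q = a p / (θ - 2 k), where θ - 2 k = u. Taking p = θ u clears the
    -- denominators.
    s θ u p q r : ℚ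
    s = a + k
    θ = s + s + t
    u = a + a + t
    p = θ * u
    q = a * θ
    r = a * u

    q≡ : q ≡ r + a * (k + k)
    q≡ = solve 3 (λ a k t → a :* ((a :+ k) :+ (a :+ k) :+ t) := a :* (a :+ a :+ t) :+ a :* (k :+ k)) refl a k t
      where open +-*-Solver using (solve; _:+_; _:*_; _:=_)

    excess : ℚ
    excess = (six * (a * a) + four * (a * k) + t * t + five * (a * t) + four * (k * t)) + ((a + a) + (a * m + a * m) + (t + t) + t * m)
      where
      two four five six : ℚ
      two  = 1ℚ + 1ℚ
      four = two + two
      five = four + 1ℚ
      six  = four + two

    -- The slack of the full row is u times the slack of the threshold quadratic plus k times a
    -- polynomial with nonnegative coefficients. The second part vanishes for k = 0, that is a = s,
    -- where the threshold is sharp.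
    extremal : (θ + 1ℚ) * p ≡
      a * p + (k + k + 1ℚ) * q + (a + a + k + 1ℚ + m) * r +
      (u * ((θ * θ + θ) - (s * θ + s * (s + s + (1ℚ + 1ℚ) + m))) + k * excess)
    extremal = solve 4 (λ a k m t →
        let one = con 1ℚ ; two = one :+ one ; four = two :+ two ; five = four :+ one ; six = four :+ two
            s = a :+ k ; θ = s :+ s :+ t ; u = a :+ a :+ t ; p = θ :* u ; q = a :* θ ; r = a :* u
        in (θ :+ one) :* p :=
          a :* p :+ (k :+ k :+ one) :* q :+ (a :+ a :+ k :+ one :+ m) :* r :+
          (u :* ((θ :* θ :+ θ) :- (s :* θ :+ s :* (s :+ s :+ two :+ m))) :+
            k :* ((six :* (a :* a) :+ four :* (a :* k) :+ t :* t :+ five :* (a :* t) :+ four :* (k :* t)) :+ ((a :+ a) :+ (a :* m :+ a :* m) :+ (t :+ t) :+ t :* m))))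
      refl a k m t
      where open +-*-Solver using (solve; con; _:+_; _:-_; _:*_; _:=_)

    -- Since q ≥ r, moving vertices from the layer none to the layer half can
    -- only increase the row sums.
    shift : ∀ b c d → a * p + (b + d) * q + c * r ≡ a * p + b * q + (c + d) * r + d * (a * (k + k))
    shift b c d = begin
      a * p + (b + d) * q + c * r
        ≡⟨ cong (λ z → a * p + (b + d) * z + c * r) q≡ ⟩
      a * p + (b + d) * (r + g) + c * r
        ≡⟨ solve 6 (λ ap b c d r g → ap :+ (b :+ d) :* (r :+ g) :+ c :* r := ap :+ b :* (r :+ g) :+ (c :+ d) :* r :+ d :* g) refl (a * p) b c d r g ⟩
      a * p + b * (r + g) + (c + d) * r + d * g
        ≡⟨ cong (λ z → a * p + b * z + (c + d) * r + d * g) (sym q≡) ⟩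
      a * p + b * q + (c + d) * r + d * g ∎
      where
      open ≡-Reasoning
      open +-*-Solver using (solve; _:+_; _:*_; _:=_)
      g = a * (k + k)

    halfRow-≡ : a * p + (k + k + 1ℚ) * q ≡ (θ + 1ℚ) * q
    halfRow-≡ = solve 3 (λ a k t →
        let one = con 1ℚ ; s = a :+ k ; θ = s :+ s :+ t ; u = a :+ a :+ t ; p = θ :* u ; q = a :* θ
        in a :* p :+ (k :+ k :+ one) :* q := (θ :+ one) :* q) refl a k t
      where open +-*-Solver using (solve; con; _:+_; _:*_; _:=_)

    noneRow-≡ : a * p ≡ θ * r
    noneRow-≡ = solve 3 (λ a θ u → a :* (θ :* u) := θ :* (a :* u)) refl a θ u
      where open +-*-Solver using (solve; _:*_; _:=_)

  2s+2+m : ∀ s m → ι (2 ℕ.* s ℕ.+ 2 ℕ.+ m) ≡ ι s + ι s + (1ℚ + 1ℚ) + ι m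
  2s+2+m s m = begin
    ι (2 ℕ.* s ℕ.+ 2 ℕ.+ m)        ≡⟨ ι-homo-+ (2 ℕ.* s ℕ.+ 2) m ⟩
    ι (2 ℕ.* s ℕ.+ 2) + ι m        ≡⟨ cong (_+ ι m) (ι-homo-+ (2 ℕ.* s) 2) ⟩
    ι (2 ℕ.* s) + ι 2 + ι m        ≡⟨ cong (λ z → ι (s ℕ.+ z) + ι 2 + ι m) (ℕₚ.+-identityʳ s) ⟩
    ι (s ℕ.+ s) + ι 2 + ι m        ≡⟨ cong (λ z → z + ι 2 + ι m) (ι-homo-+ s s) ⟩
    ι s + ι s + (1ℚ + 1ℚ) + ι m    ∎
    where open ≡-Reasoning

  ι-double : ∀ k → ι (k ℕ.+ k ℕ.+ 1) ≡ ι k + ι k + 1ℚ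
  ι-double k = trans (ι-homo-+ (k ℕ.+ k) 1) (cong (_+ 1ℚ) (ι-homo-+ k k))

  above⇒2s≤θ : ∀ {s m θ} → AboveThreshold s (2 ℕ.* s ℕ.+ 2 ℕ.+ m) θ → ι s + ι s ≤ θ
  above⇒2s≤θ {s} {m} {θ} (0≤θ , above) =
    2s≤θ (ι s) (ι m) θ (0≤ι s) (0≤ι m) 0≤θ (subst (λ z → ι s * θ + ι s * z ≤ θ * θ + θ) (2s+2+m s m) above)

  -- For a = 0 the weights q and r of `ExtremalWeights` vanish. The constant 1 replaces them, since
  -- the half layer is at most a clique on 2 s + 1 ≤ θ + 1 vertices; the full layer is empty, and b
  -- + c is a positive p satisfying its row.
  uniform-weights : ∀ s m θ b c → b ℕ.≤ s ℕ.+ s ℕ.+ 1 → b ℕ.+ c ≡ 3 ℕ.* s ℕ.+ 2 ℕ.+ m →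
    AboveThreshold s (2 ℕ.* s ℕ.+ 2 ℕ.+ m) θ → LayerWeights 0 b c θ
  uniform-weights s m θ b c b≤ b+c≡ above@(0≤θ , _) = record
    { p = P ; q = 1ℚ ; r = 1ℚ
    ; 0<p = subst (0ℚ <_) (trans (cong ι (sym (trans b+c≡ (positive s m)))) (ι-homo-+ b c)) (ι-suc-pos (3 ℕ.* s ℕ.+ 1 ℕ.+ m))
    ; 0<q = ℚₚ.positive⁻¹ 1ℚ
    ; 0<r = ℚₚ.positive⁻¹ 1ℚ
    ; fullRow = ≤-from-≡+ (θ * P) (solve 3 (λ β γ θ → (θ :+ con 1ℚ) :* (β :+ γ) := (con 0ℚ :* (β :+ γ) :+ β :* con 1ℚ :+ γ :* con 1ℚ) :+ θ :* (β :+ γ)) refl (ι b) (ι c) θ)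
        (0≤* 0≤θ (0≤+ (0≤ι b) (0≤ι c)))
    ; halfRow = begin
        ι 0 * P + ι b * 1ℚ ≡⟨ solve 2 (λ P β → con 0ℚ :* P :+ β :* con 1ℚ := β) refl P (ι b) ⟩
        ι b                ≤⟨ ι-mono-≤ b≤ ⟩
        ι (s ℕ.+ s ℕ.+ 1)  ≡⟨ ι-double s ⟩
        ι s + ι s + 1ℚ     ≤⟨ ℚₚ.+-monoˡ-≤ 1ℚ (above⇒2s≤θ {s} {m} above) ⟩
        θ + 1ℚ             ≡⟨ sym (ℚₚ.*-identityʳ (θ + 1ℚ)) ⟩
        (θ + 1ℚ) * 1ℚ      ∎
    ; noneRow = ℚₚ.≤-trans (ℚₚ.≤-reflexive (ℚₚ.*-zeroˡ P)) (ℚₚ.≤-trans 0≤θ (ℚₚ.≤-reflexive (sym (ℚₚ.*-identityʳ θ))))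
    }
    where
    open ℚₚ.≤-Reasoning
    open +-*-Solver using (solve; con; _:+_; _:*_; _:=_)
    P : ℚ
    P = ι b + ι c
    positive : ∀ s m → 3 ℕ.* s ℕ.+ 2 ℕ.+ m ≡ suc (3 ℕ.* s ℕ.+ 1 ℕ.+ m)
    positive = ℕ-Solver.solve-∀

  extremal-weights : ∀ a k m d b c t → b ℕ.+ d ≡ k ℕ.+ k ℕ.+ 1 → c ≡ (suc a ℕ.+ suc a ℕ.+ k ℕ.+ 1 ℕ.+ m) ℕ.+ d →
    0ℚ ≤ t →
    AboveThreshold (suc a ℕ.+ k) (2 ℕ.* (suc a ℕ.+ k) ℕ.+ 2 ℕ.+ m) (ι (suc a) + ι k + (ι (suc a) + ι k) + t) →
    LayerWeights (suc a) b c (ι (suc a) + ι k + (ι (suc a) + ι k) + t)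
  extremal-weights a′ k′ m′ d′ b′ c′ t b+d≡ c≡ 0≤t (0≤θ , above) = record
    { p = p ; q = q ; r = r
    ; 0<p = 0<* 0<θ 0<u
    ; 0<q = 0<* 0<a 0<θ
    ; 0<r = 0<* 0<a 0<u
    -- The half layer falls short of 2 k + 1 by d vertices; moving d vertices there from none leads
    -- to the extremal sizes.
    ; fullRow = begin
        a * p + b * q + ι c′ * r
          ≡⟨ cong (λ z → a * p + b * q + z * r) c≡ℚ ⟩
        a * p + b * q + (c₀ + d) * r
          ≤⟨ p≤p+q (0≤* (0≤ι d′) (0≤* (0≤ι (suc a′)) (0≤+ (0≤ι k′) (0≤ι k′)))) ⟩
        a * p + b * q + (c₀ + d) * r + d * (a * (k + k))
          ≡⟨ sym (shift b c₀ d) ⟩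
        a * p + (b + d) * q + c₀ * r
          ≡⟨ cong (λ z → a * p + z * q + c₀ * r) b+d≡ℚ ⟩
        a * p + (k + k + 1ℚ) * q + c₀ * r
          ≤⟨ p≤p+q (0≤+ (0≤* (ℚₚ.<⇒≤ 0<u) (p≤q⇒0≤q-p above′)) (0≤* (0≤ι k′) 0≤excess)) ⟩
        a * p + (k + k + 1ℚ) * q + c₀ * r + (u * ((θ * θ + θ) - (s * θ + s * (s + s + (1ℚ + 1ℚ) + m))) + k * excess)
          ≡⟨ sym extremal ⟩
        (θ + 1ℚ) * p ∎
    ; halfRow = begin
        a * p + b * q
          ≤⟨ ℚₚ.+-monoʳ-≤ (a * p) (ℚₚ.*-monoʳ-≤-nonNeg q {{ℚ.nonNegative (0≤* (0≤ι (suc a′)) 0≤θ)}} (p≤p+q {b} {d} (0≤ι d′))) ⟩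
        a * p + (b + d) * q
          ≡⟨ cong (λ z → a * p + z * q) b+d≡ℚ ⟩
        a * p + (k + k + 1ℚ) * q
          ≡⟨ halfRow-≡ ⟩
        (θ + 1ℚ) * q ∎
    ; noneRow = ℚₚ.≤-reflexive noneRow-≡
    }
    where
    open ℚₚ.≤-Reasoning
    open ExtremalWeights (ι (suc a′)) (ι k′) (ι m′) t
    a b k m d c₀ : ℚ
    a  = ι (suc a′)
    b  = ι b′
    k  = ι k′
    m  = ι m′
    d  = ι d′
    c₀ = a + a + k + 1ℚ + m
    b+d≡ℚ : b + d ≡ k + k + 1ℚ
    b+d≡ℚ = trans (sym (ι-homo-+ b′ d′)) (trans (cong ι b+d≡) (ι-double k′))
    c≡ℚ : ι c′ ≡ c₀ + d
    c≡ℚ = begin-equality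
      ι c′                                    ≡⟨ cong ι c≡ ⟩
      ι (n₂ ℕ.+ k′ ℕ.+ 1 ℕ.+ m′ ℕ.+ d′)      ≡⟨ ι-homo-+ (n₂ ℕ.+ k′ ℕ.+ 1 ℕ.+ m′) d′ ⟩
      ι (n₂ ℕ.+ k′ ℕ.+ 1 ℕ.+ m′) + d         ≡⟨ cong (_+ d) (ι-homo-+ (n₂ ℕ.+ k′ ℕ.+ 1) m′) ⟩
      ι (n₂ ℕ.+ k′ ℕ.+ 1) + m + d            ≡⟨ cong (λ z → z + m + d) (ι-homo-+ (n₂ ℕ.+ k′) 1) ⟩
      ι (n₂ ℕ.+ k′) + 1ℚ + m + d             ≡⟨ cong (λ z → z + 1ℚ + m + d) (ι-homo-+ n₂ k′) ⟩
      ι n₂ + k + 1ℚ + m + d                   ≡⟨ cong (λ z → z + k + 1ℚ + m + d) (ι-homo-+ (suc a′) (suc a′)) ⟩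
      c₀ + d                                  ∎
      where
      n₂ : ℕ
      n₂ = suc a′ ℕ.+ suc a′
    0<a : 0ℚ < a
    0<a = ι-suc-pos a′
    0<u : 0ℚ < u
    0<u = ℚₚ.+-mono-<-≤ (ℚₚ.+-mono-< 0<a 0<a) 0≤t
    0<s : 0ℚ < s
    0<s = ℚₚ.+-mono-<-≤ 0<a (0≤ι k′)
    0<θ : 0ℚ < θ
    0<θ = ℚₚ.+-mono-<-≤ (ℚₚ.+-mono-< 0<s 0<s) 0≤t
    above′ : s * θ + s * (s + s + (1ℚ + 1ℚ) + m) ≤ θ * θ + θ
    above′ = subst (λ z → z * θ + z * (z + z + (1ℚ + 1ℚ) + m) ≤ θ * θ + θ) (ι-homo-+ (suc a′) k′)
      (subst (λ z → ι (suc a′ ℕ.+ k′) * θ + ι (suc a′ ℕ.+ k′) * z ≤ θ * θ + θ) (2s+2+m (suc a′ ℕ.+ k′) m′) above)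
    0≤a = 0≤ι (suc a′)
    0≤k = 0≤ι k′
    0≤m = 0≤ι m′
    0≤excess : 0ℚ ≤ excess
    0≤excess = 0≤+
      (0≤+ (0≤+ (0≤+ (0≤+ (0≤* (0≤ι 6) (0≤* 0≤a 0≤a)) (0≤* (0≤ι 4) (0≤* 0≤a 0≤k))) (0≤* 0≤t 0≤t)) (0≤* (0≤ι 5) (0≤* 0≤a 0≤t))) (0≤* (0≤ι 4) (0≤* 0≤k 0≤t)))
      (0≤+ (0≤+ (0≤+ (0≤+ 0≤a 0≤a) (0≤+ (0≤* 0≤a 0≤m) (0≤* 0≤a 0≤m))) (0≤+ 0≤t 0≤t)) (0≤* 0≤t 0≤m))

  -- For a > 0 the data are measured by their distance from the extremal layering: k = s - a, d = 2
  -- k + 1 - b and t = θ - 2 s, all nonnegative.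
  layer-weights : ∀ s m θ a b c → a ℕ.+ a ℕ.+ b ℕ.≤ s ℕ.+ s ℕ.+ 1 → a ℕ.+ b ℕ.+ c ≡ 3 ℕ.* s ℕ.+ 2 ℕ.+ m →
    AboveThreshold s (2 ℕ.* s ℕ.+ 2 ℕ.+ m) θ → LayerWeights a b c θ
  layer-weights s m θ zero    b c few size above = uniform-weights s m θ b c few size above
  layer-weights s m θ (suc a) b c few size above with ℕₚ.m≤n⇒∃[o]m+o≡n a≤s
    where
    a≤s : suc a ℕ.≤ s
    a≤s = ℕₚ.≮⇒≥ λ s<a → ℕₚ.<-irrefl refl (begin-strict
      s ℕ.+ s ℕ.+ 1           <⟨ ℕₚ.n<1+n _ ⟩
      suc (s ℕ.+ s ℕ.+ 1)     ≡⟨ regroup s ⟩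
      suc s ℕ.+ suc s         ≤⟨ ℕₚ.+-mono-≤ s<a s<a ⟩
      suc a ℕ.+ suc a         ≤⟨ ℕₚ.m≤m+n _ b ⟩
      suc a ℕ.+ suc a ℕ.+ b   ≤⟨ few ⟩
      s ℕ.+ s ℕ.+ 1           ∎)
      where
      open ℕₚ.≤-Reasoning
      regroup : ∀ s → suc (s ℕ.+ s ℕ.+ 1) ≡ suc s ℕ.+ suc s
      regroup = ℕ-Solver.solve-∀
  ... | k , refl with ℕₚ.m≤n⇒∃[o]m+o≡n b≤2k+1
    where
    b≤2k+1 : b ℕ.≤ k ℕ.+ k ℕ.+ 1
    b≤2k+1 = ℕₚ.+-cancelˡ-≤ (suc a ℕ.+ suc a) b (k ℕ.+ k ℕ.+ 1) (ℕₚ.≤-trans few (ℕₚ.≤-reflexive (regroup (suc a) k)))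
      where
      regroup : ∀ a k → a ℕ.+ k ℕ.+ (a ℕ.+ k) ℕ.+ 1 ≡ a ℕ.+ a ℕ.+ (k ℕ.+ k ℕ.+ 1)
      regroup = ℕ-Solver.solve-∀
  ... | d , b+d≡ = subst (LayerWeights (suc a) b c) (sym θ≡)
    (extremal-weights a k m d b c (θ - (ι (suc a ℕ.+ k) + ι (suc a ℕ.+ k))) b+d≡ c≡ (p≤q⇒0≤q-p (above⇒2s≤θ {suc a ℕ.+ k} {m} above))
      (subst (AboveThreshold (suc a ℕ.+ k) (2 ℕ.* (suc a ℕ.+ k) ℕ.+ 2 ℕ.+ m)) θ≡ above))
    where
    c≡ : c ≡ (suc a ℕ.+ suc a ℕ.+ k ℕ.+ 1 ℕ.+ m) ℕ.+ d
    c≡ = ℕₚ.+-cancelˡ-≡ (suc a ℕ.+ b) c _ (trans size (trans (regroup (suc a) k m) (trans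
      (cong (λ z → suc a ℕ.+ z ℕ.+ (suc a ℕ.+ suc a ℕ.+ k ℕ.+ 1 ℕ.+ m)) (sym b+d≡)) (regroup′ (suc a) b d (suc a ℕ.+ suc a ℕ.+ k ℕ.+ 1 ℕ.+ m)))))
      where
      regroup : ∀ a k m → 3 ℕ.* (a ℕ.+ k) ℕ.+ 2 ℕ.+ m ≡ a ℕ.+ (k ℕ.+ k ℕ.+ 1) ℕ.+ (a ℕ.+ a ℕ.+ k ℕ.+ 1 ℕ.+ m)
      regroup = ℕ-Solver.solve-∀
      regroup′ : ∀ a b d x → a ℕ.+ (b ℕ.+ d) ℕ.+ x ≡ a ℕ.+ b ℕ.+ (x ℕ.+ d)
      regroup′ = ℕ-Solver.solve-∀
    θ≡ : θ ≡ ι (suc a) + ι k + (ι (suc a) + ι k) + (θ - (ι (suc a ℕ.+ k) + ι (suc a ℕ.+ k)))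
    θ≡ = trans (cancel (ι (suc a ℕ.+ k)) θ) (cong (λ z → z + z + (θ - (ι (suc a ℕ.+ k) + ι (suc a ℕ.+ k)))) (ι-homo-+ (suc a) k))
      where
      open +-*-Solver using (solve; _:+_; _:-_; _:=_)
      cancel : ∀ x θ → θ ≡ x + x + (θ - (x + x))
      cancel = solve 2 (λ x θ → θ := x :+ x :+ (θ :- (x :+ x))) refl

  -- From integers to Cauchy reals

  layering-bounds-eigenvalues : ∀ {N} (G : SimpleGraph N) s m → N ≡ 3 ℕ.* s ℕ.+ 2 ℕ.+ m → LinkLayering G s →
    ∀ θ → AboveThreshold s (2 ℕ.* s ℕ.+ 2 ℕ.+ m) θ → ∀ ρ → IsEigenvalue (adjacencyMatrix G) ρ → ρ ≤ℝ fromℚ θ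
  layering-bounds-eigenvalues G s m N≡ (ℓ , few , joined) θ above =
    let a , b , c , size , score≡ , total = tally ℓ
        y , 0<y , Ay≤θy = test-vector G ℓ joined total
          (layer-weights s m θ a b c (subst (ℕ._≤ s ℕ.+ s ℕ.+ 1) (sym score≡) few) (trans size N≡) above)
    in eigenvalue-bound G y 0<y θ (proj₁ above) Ay≤θy

  -- The common form of both spectral hypotheses; a rational θ in place of the irrational threshold
  -- keeps the test vector rational.
  SpectrallyLarge : ℕ → ℕ → ℝ → Set
  SpectrallyLarge s M ρ = ∃ λ θ → AboveThreshold s M θ × fromℚ θ <ℝ ρ

  integral-matching : ∀ {N} s m → suc N ≡ 3 ℕ.* s ℕ.+ 3 ℕ.+ m → (H : 3-Graph (suc N)) (ρ : Fin (suc N) → ℝ) →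
    (∀ v → IsSpectralRadius (link H v) (ρ v)) → (∀ v → SpectrallyLarge s (2 ℕ.* s ℕ.+ 2 ℕ.+ m) (ρ v)) →
    FractionalMatching (edges H) (s ℕ.+ 1)
  integral-matching {N} s m n≡ H ρ isρ large =
    conclude (Duality.duality (edges H) (Uniqueₚ.filter⁺ (T? ∘ isEdge H) (subsets-unique (suc N))) (s ℕ.+ 1))
    where
    regroup : ∀ s m → 3 ℕ.* s ℕ.+ 3 ℕ.+ m ≡ suc (3 ℕ.* s ℕ.+ 2 ℕ.+ m)
    regroup = ℕ-Solver.solve-∀
    refute : (∃ λ v → LinkLayering (link H v) s) → ⊥
    refute (v , layering) = let θ , above , θ<ρ = large v in
      layering-bounds-eigenvalues (link H v) s m (ℕₚ.suc-injective (trans n≡ (regroup s m))) layering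
        θ above (ρ v) (proj₁ (isρ v)) θ<ρ
    conclude : FractionalMatching (edges H) (s ℕ.+ 1) ⊎ FractionalCover (edges H) (s ℕ.+ 1) → FractionalMatching (edges H) (s ℕ.+ 1)
    conclude (inj₁ matching) = matching
    conclude (inj₂ cover)    = ⊥-elim (refute (link-layering s
      (subst (3 ℕ.* s ℕ.+ 3 ℕ.≤_) (sym n≡) (ℕₚ.m≤m+n (3 ℕ.* s ℕ.+ 3) m)) H cover))

  pointwise-≤ℝ : ∀ x y → (∀ k → seq x k ≤ seq y k) → x ≤ℝ y
  pointwise-≤ℝ x y x≤y (ε , 0<ε , K , h) = ℚₚ.<-irrefl refl (begin-strict
    seq y K      ≡⟨ sym (ℚₚ.+-identityʳ (seq y K)) ⟩
    seq y K + 0ℚ <⟨ ℚₚ.+-monoʳ-< (seq y K) 0<ε ⟩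
    seq y K + ε  ≤⟨ h K ℕₚ.≤-refl ⟩
    seq x K      ≤⟨ x≤y K ⟩
    seq y K      ∎)
    where open ℚₚ.≤-Reasoning

  pointwise-≃ : ∀ x y → (∀ k → seq x k ≡ seq y k) → x ≃ y
  pointwise-≃ x y x≡y ε 0<ε = 0 , λ k _ → subst (λ z → ℚ.∣ z ∣ ≤ ε)
    (sym (trans (cong (_- seq y k) (x≡y k)) (ℚₚ.+-inverseʳ (seq y k)))) (ℚₚ.<⇒≤ 0<ε)

  -- Integer matchings as real fractional matchings.

  /-cross-≡ : ∀ a b k l → a ℕ.* suc l ≡ b ℕ.* suc k → + a / suc k ≡ + b / suc l
  /-cross-≡ a b k l eq = ℚₚ.≤-antisym (/-mono-≤ a b k l (ℕₚ.≤-reflexive eq)) (/-mono-≤ b a l k (ℕₚ.≤-reflexive (sym eq)))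

  seq-sumList : ∀ {A : Set} (y : A → ℕ) d es k →
    seq (sumList (λ e → fromℚ (+ y e / suc d)) es) k ≡ + listSum y es / suc d
  seq-sumList y d [] k = /-cross-≡ 0 0 0 d refl
  seq-sumList y d (e ∷ es) k = trans (cong (_+_ (+ y e / suc d)) (seq-sumList y d es k)) (sym (/-homo-+ (y e) (listSum y es) d))

  listSum-filterᵇ : ∀ {A : Set} (y : A → ℕ) p es → listSum y (filterᵇ p es) ≡ listSum (λ e → 𝟙 (p e) ℕ.* y e) es
  listSum-filterᵇ y p [] = refl
  listSum-filterᵇ y p (e ∷ es) with p e
  ... | true  = cong₂ ℕ._+_ (sym (ℕₚ.+-identityʳ (y e))) (listSum-filterᵇ y p es)
  ... | false = listSum-filterᵇ y p es

  listSum-*ʳ : ∀ {A : Set} (y : A → ℕ) c es → listSum (λ e → y e ℕ.* c) es ≡ listSum y es ℕ.* c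
  listSum-*ʳ y c [] = refl
  listSum-*ʳ y c (e ∷ es) = trans (cong (ℕ._+_ (y e ℕ.* c)) (listSum-*ʳ y c es)) (sym (ℕₚ.*-distribʳ-+ c (y e) (listSum y es)))

  sum-𝟙 : ∀ {n} (e : Subset n) → ℕSum.sum (λ v → 𝟙 (lookup e v)) ≡ ∣ e ∣
  sum-𝟙 []            = refl
  sum-𝟙 (outside ∷ e) = sum-𝟙 e
  sum-𝟙 (inside ∷ e)  = cong suc (sum-𝟙 e)

  -- Double counting: each edge contributes its value once at each of its r vertices.
  handshake : ∀ {n r} (y : Subset n → ℕ) {es} → All (λ e → ∣ e ∣ ≡ r) es →
    ℕSum.sum (λ v → listSum (λ e → 𝟙 (lookup e v) ℕ.* y e) es) ≡ r ℕ.* listSum y es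
  handshake {n} {r} y [] = trans (ℕSum.sum-replicate-zero n) (sym (ℕₚ.*-zeroʳ r))
  handshake {n} {r} y {e ∷ es} (∣e∣≡r ∷ rest) = begin
    ℕSum.sum (λ v → 𝟙 (lookup e v) ℕ.* y e ℕ.+ listSum (λ e → 𝟙 (lookup e v) ℕ.* y e) es)
      ≡⟨ ℕSum.∑-distrib-+ (λ v → 𝟙 (lookup e v) ℕ.* y e) (λ v → listSum (λ e → 𝟙 (lookup e v) ℕ.* y e) es) ⟩
    ℕSum.sum (λ v → 𝟙 (lookup e v) ℕ.* y e) ℕ.+ ℕSum.sum (λ v → listSum (λ e → 𝟙 (lookup e v) ℕ.* y e) es)
      ≡⟨ cong₂ ℕ._+_ (sym (ℕSum.*-distribʳ-sum (y e) (λ v → 𝟙 (lookup e v)))) (handshake y rest) ⟩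
    ℕSum.sum (λ v → 𝟙 (lookup e v)) ℕ.* y e ℕ.+ r ℕ.* listSum y es
      ≡⟨ cong (λ z → z ℕ.* y e ℕ.+ r ℕ.* listSum y es) (trans (sum-𝟙 e) ∣e∣≡r) ⟩
    r ℕ.* y e ℕ.+ r ℕ.* listSum y es
      ≡⟨ sym (ℕₚ.*-distribˡ-+ r (y e) (listSum y es)) ⟩
    r ℕ.* (y e ℕ.+ listSum y es) ∎
    where open ≡-Reasoning

  sum-tight : ∀ {n} (S : Fin n → ℕ) t → (∀ v → S v ℕ.≤ t) → n ℕ.* t ℕ.≤ ℕSum.sum S → ∀ v → S v ≡ t
  sum-tight {suc n} S t S≤t h zero = ℕₚ.≤-antisym (S≤t zero)
    (ℕₚ.+-cancelʳ-≤ (n ℕ.* t) t (S zero) (ℕₚ.≤-trans h (ℕₚ.+-monoʳ-≤ (S zero)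
      (ℕₚ.≤-trans (sum-mono (S≤t ∘ suc)) (ℕₚ.≤-reflexive (sum-const n t))))))
  sum-tight {suc n} S t S≤t h (suc v) = sum-tight (S ∘ suc) t (S≤t ∘ suc)
    (ℕₚ.+-cancelˡ-≤ t (n ℕ.* t) (ℕSum.sum (S ∘ suc)) (ℕₚ.≤-trans h (ℕₚ.+-monoˡ-≤ (ℕSum.sum (S ∘ suc)) (S≤t zero)))) v

  nonempty : ∀ {n} (e : Subset n) {r} → ∣ e ∣ ≡ suc r → ∃ λ v → lookup e v ≡ inside
  nonempty (inside ∷ e)  _     = zero , refl
  nonempty (outside ∷ e) ∣e∣≡ = let v , v∈e = nonempty e ∣e∣≡ in suc v , v∈e

  module RealMatching {n r} (H : UniformHypergraph (suc r) n) (y : Subset n → ℕ) (d : ℕ)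
    (packed : ∀ v → listSum (λ e → 𝟙 (lookup e v) ℕ.* y e) (edges H) ℕ.≤ suc d) where

    f : Subset n → ℝ
    f e = fromℚ (+ y e / suc d)

    load : Fin n → ℕ
    load v = listSum (λ e → 𝟙 (lookup e v) ℕ.* y e) (edges H)

    seq-load : ∀ v k → seq (sumList f (edgesAt H v)) k ≡ + load v / suc d
    seq-load v k = trans (seq-sumList y d (edgesAt H v) k)
      (cong (λ z → + z / suc d) (listSum-filterᵇ y (λ e → lookup e v) (edges H)))

    -- An edge of size r + 1 has a vertex, and the load at that vertex includes y e.
    y≤1+d : ∀ e → T (isEdge H e) → y e ℕ.≤ suc d
    y≤1+d e edge = let v , v∈e = nonempty e (uniform H e edge) in begin
      y e                             ≡⟨ sym (ℕₚ.*-identityˡ (y e)) ⟩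
      1 ℕ.* y e                       ≡⟨ cong (λ b → 𝟙 b ℕ.* y e) (sym v∈e) ⟩
      𝟙 (lookup e v) ℕ.* y e          ≤⟨ ∈⇒≤listSum (λ e → 𝟙 (lookup e v) ℕ.* y e) (∈-filter⁺ (T? ∘ isEdge H) (subsets-complete e) edge) ⟩
      load v                          ≤⟨ packed v ⟩
      suc d                           ∎
      where open ℕₚ.≤-Reasoning

    isFractionalMatching : IsFractionalMatching H f
    isFractionalMatching =
      (λ e edge → pointwise-≤ℝ 0ℝ (f e) (λ _ → /-mono-≤ 0 (y e) 0 d z≤n) ,
                  pointwise-≤ℝ (f e) 1ℝ (λ _ → /-mono-≤ (y e) 1 d 0 (subst₂ ℕ._≤_ (sym (ℕₚ.*-identityʳ (y e))) (sym (ℕₚ.*-identityˡ (suc d))) (y≤1+d e edge)))) ,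
      λ v → pointwise-≤ℝ (sumList f (edgesAt H v)) 1ℝ λ k → subst (_≤ 1ℚ) (sym (seq-load v k))
        (/-mono-≤ (load v) 1 d 0 (subst₂ ℕ._≤_ (sym (ℕₚ.*-identityʳ (load v))) (sym (ℕₚ.*-identityˡ (suc d))) (packed v)))

    ofSize : ∀ c → listSum y (edges H) ≡ c ℕ.* suc d → HasFractionalMatchingOfSize H (fromℕ c)
    ofSize c total = f , isFractionalMatching , pointwise-≃ (size H f) (fromℕ c) λ k →
      trans (seq-sumList y d (edges H) k) (/-cross-≡ (listSum y (edges H)) c d 0 (trans (ℕₚ.*-identityʳ _) total))

    -- By `handshake` the n loads add up to (r + 1) c (d + 1) = n (d + 1) while none exceeds d + 1,
    -- so each equals d + 1.
    perfect : ∀ c → n ≡ suc r ℕ.* c → listSum y (edges H) ≡ c ℕ.* suc d → HasPerfectFractionalMatching H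
    perfect c n≡ total = f , isFractionalMatching , λ v → pointwise-≃ (sumList f (edgesAt H v)) 1ℝ λ k →
      trans (seq-load v k) (/-cross-≡ (load v) 1 d 0 (trans (ℕₚ.*-identityʳ (load v)) (trans (tight v) (sym (ℕₚ.*-identityˡ (suc d))))))
      where
      allUniform : All (λ e → ∣ e ∣ ≡ suc r) (edges H)
      allUniform = All.map (uniform H _) (Allₚ.all-filter (T? ∘ isEdge H) (subsets n))
      tight : ∀ v → load v ≡ suc d
      tight = sum-tight load (suc d) packed (ℕₚ.≤-reflexive (begin
        n ℕ.* suc d                    ≡⟨ cong (ℕ._* suc d) n≡ ⟩
        suc r ℕ.* c ℕ.* suc d          ≡⟨ ℕₚ.*-assoc (suc r) c (suc d) ⟩
        suc r ℕ.* (c ℕ.* suc d)        ≡⟨ cong (suc r ℕ.*_) (sym total) ⟩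
        suc r ℕ.* listSum y (edges H)  ≡⟨ sym (handshake y allUniform) ⟩
        ℕSum.sum load                  ∎))
        where open ≡-Reasoning

  ScaledMatching : ∀ {n} → List (Subset n) → ℕ → Set
  ScaledMatching {n} es c = ∃₂ λ (y : Subset n → ℕ) d →
    (∀ v → listSum (λ e → 𝟙 (lookup e v) ℕ.* y e) es ℕ.≤ suc d) × listSum y es ≡ c ℕ.* suc d

  -- With t the total of f, the matching f / L has size t / L, at least c + 1. Shrinking it by the
  -- factor (c + 1) L / t makes the size exact: numerators (c + 1) f over the denominator t.
  scale : ∀ {n} (es : List (Subset n)) c → FractionalMatching es (suc c) → ScaledMatching es (suc c)
  scale {n} es c (f , L , 0<L , packed , large) = rescaled (listSum f es) refl
    where
    rescaled : ∀ t → listSum f es ≡ t → ScaledMatching es (suc c)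
    rescaled zero    eq = contradiction (ℕₚ.≤-trans (ℕₚ.≤-trans 0<L (ℕₚ.m≤m+n L (c ℕ.* L))) (subst (suc c ℕ.* L ℕ.≤_) eq large)) λ ()
    rescaled (suc d) eq = (λ e → f e ℕ.* suc c) , d ,
      (λ v → begin
        listSum (λ e → 𝟙 (lookup e v) ℕ.* (f e ℕ.* suc c)) es
          ≡⟨ listSum-cong (All.universal (λ e → sym (ℕₚ.*-assoc (𝟙 (lookup e v)) (f e) (suc c))) es) ⟩
        listSum (λ e → 𝟙 (lookup e v) ℕ.* f e ℕ.* suc c) es
          ≡⟨ listSum-*ʳ (λ e → 𝟙 (lookup e v) ℕ.* f e) (suc c) es ⟩
        listSum (λ e → 𝟙 (lookup e v) ℕ.* f e) es ℕ.* suc c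
          ≤⟨ ℕₚ.*-monoˡ-≤ (suc c) (packed v) ⟩
        L ℕ.* suc c
          ≡⟨ ℕₚ.*-comm L (suc c) ⟩
        suc c ℕ.* L
          ≤⟨ large ⟩
        listSum f es
          ≡⟨ eq ⟩
        suc d ∎) ,
      trans (listSum-*ʳ f (suc c) es) (trans (cong (ℕ._* suc c) eq) (ℕₚ.*-comm (suc d) (suc c)))
      where open ℕₚ.≤-Reasoning

  -- Rational values of θ from the two thresholds.

  reciprocal-≤ : ∀ ε → 0ℚ < ε → ∃ λ K → ∀ k → K ℕ.≤ k → + 1 / suc k ≤ ε
  reciprocal-≤ (mkℚ (+ zero) d c) 0<ε with () ← ℚ.positive 0<ε
  reciprocal-≤ (mkℚ -[1+ a ] d c) 0<ε with () ← ℚ.positive 0<ε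
  reciprocal-≤ ε@(mkℚ +[1+ a ] d c) 0<ε = d , λ k d≤k → subst (+ 1 / suc k ≤_) (ℚₚ.↥p/↧p≡p ε)
    (/-mono-≤ 1 (suc a) k d (ℕₚ.*-mono-≤ (s≤s (z≤n {a})) (s≤s d≤k)))

  -- The terms of `√ m` approximate from below, whereas θ must not fall below the threshold; raising
  -- the numerator by one gives approximations from above.
  √-upper : ℕ → ℕ → ℚ
  √-upper m k = + suc (√-numerator m k) / suc k

  √-upper-square : ∀ m k → ι m ≤ √-upper m k * √-upper m k
  √-upper-square m k = subst (ι m ≤_) (sym (/-homo-* a a k k))
    (/-mono-≤ m (a ℕ.* a) 0 (k ℕ.+ k ℕ.* suc k)
      (ℕₚ.≤-trans (ℕₚ.<⇒≤ (⌊√⌋-upper (m ℕ.* (suc k ℕ.* suc k)))) (ℕₚ.≤-reflexive (sym (ℕₚ.*-identityʳ (a ℕ.* a))))))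
    where a = suc (√-numerator m k)

  -- The two indices are independent: k is frozen when θ is defined, l runs along the sequences
  -- being compared.
  √-upper-close : ∀ m ε → 0ℚ < ε → ∃ λ K → ∀ k l → K ℕ.≤ k → K ℕ.≤ l → √-upper m k ≤ seq (√ m) l + ε
  √-upper-close m ε 0<ε = K₁ ℕ.⊔ K₂ , λ k l ≤k ≤l → begin
    √-upper m k
      ≡⟨ trans (cong (λ z → + z / suc k) (ℕₚ.+-comm 1 (√-numerator m k))) (/-homo-+ (√-numerator m k) 1 k) ⟩
    √-seq m k + + 1 / suc k
      ≤⟨ ℚₚ.+-mono-≤ (below k l (proj₂ near k l (ℕₚ.m⊔n≤o⇒m≤o K₁ K₂ ≤k) (ℕₚ.m⊔n≤o⇒m≤o K₁ K₂ ≤l)))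
           (proj₂ small k (ℕₚ.m⊔n≤o⇒n≤o K₁ K₂ ≤k)) ⟩
    √-seq m l + ½ * ε + ½ * ε
      ≡⟨ solve 2 (λ x ε → x :+ con ½ :* ε :+ con ½ :* ε := x :+ ε) refl (√-seq m l) ε ⟩
    √-seq m l + ε ∎
    where
    open ℚₚ.≤-Reasoning
    open +-*-Solver using (solve; con; _:+_; _:-_; _:*_; _:=_)
    0<½ε : 0ℚ < ½ * ε
    0<½ε = 0<* (ℚₚ.positive⁻¹ ½) 0<ε
    near = cauchy (√ m) (½ * ε) 0<½ε
    small = reciprocal-≤ (½ * ε) 0<½ε
    K₁ K₂ : ℕ
    K₁ = proj₁ near
    K₂ = proj₁ small
    below : ∀ k l → ℚ.∣ √-seq m k - √-seq m l ∣ ≤ ½ * ε → √-seq m k ≤ √-seq m l + ½ * ε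
    below k l h = begin
      √-seq m k
        ≡⟨ solve 2 (λ x y → x := y :+ (x :- y)) refl (√-seq m k) (√-seq m l) ⟩
      √-seq m l + (√-seq m k - √-seq m l)
        ≤⟨ ℚₚ.+-monoʳ-≤ (√-seq m l) (ℚₚ.≤-trans (p≤∣p∣ (√-seq m k - √-seq m l)) h) ⟩
      √-seq m l + ½ * ε ∎

  -- Here s is the s - 1 of the theorem. For θ = (s + r) / 2 one has θ² - s θ = (r² - s²) / 4, so
  -- the slack of the quadratic is a quarter of the slack in the hypothesis on r².
  above-√ : ∀ s M r → 0ℚ ≤ r → ι (s ℕ.* s ℕ.+ 4 ℕ.* suc s ℕ.* M) ≤ r * r → AboveThreshold (suc s) M (½ * (ι s + r))
  above-√ s M r 0≤r h = 0≤* (ℚₚ.<⇒≤ (ℚₚ.positive⁻¹ ½)) (0≤+ (0≤ι s) 0≤r) ,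
    subst (λ z → z * θ + z * ι M ≤ θ * θ + θ) (sym (ι-homo-+ 1 s))
      (≤-from-≡+ (½ * ½ * (r * r - (ι s * ι s + ι 4 * (1ℚ + ι s) * ι M))) identity
        (0≤* (0≤* (ℚₚ.<⇒≤ (ℚₚ.positive⁻¹ ½)) (ℚₚ.<⇒≤ (ℚₚ.positive⁻¹ ½))) (p≤q⇒0≤q-p (subst (_≤ r * r) radicand h))))
    where
    θ : ℚ
    θ = ½ * (ι s + r)
    radicand : ι (s ℕ.* s ℕ.+ 4 ℕ.* suc s ℕ.* M) ≡ ι s * ι s + ι 4 * (1ℚ + ι s) * ι M
    radicand = begin
      ι (s ℕ.* s ℕ.+ 4 ℕ.* suc s ℕ.* M)       ≡⟨ ι-homo-+ (s ℕ.* s) (4 ℕ.* suc s ℕ.* M) ⟩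
      ι (s ℕ.* s) + ι (4 ℕ.* suc s ℕ.* M)     ≡⟨ cong₂ _+_ (ι-homo-* s s) (ι-homo-* (4 ℕ.* suc s) M) ⟩
      ι s * ι s + ι (4 ℕ.* suc s) * ι M       ≡⟨ cong (λ z → ι s * ι s + z * ι M) (ι-homo-* 4 (suc s)) ⟩
      ι s * ι s + ι 4 * ι (suc s) * ι M       ≡⟨ cong (λ z → ι s * ι s + ι 4 * z * ι M) (ι-homo-+ 1 s) ⟩
      ι s * ι s + ι 4 * (1ℚ + ι s) * ι M      ∎
      where open ≡-Reasoning
    open +-*-Solver using (solve; con; _:+_; _:-_; _:*_; _:=_)
    identity : θ * θ + θ ≡ (1ℚ + ι s) * θ + (1ℚ + ι s) * ι M + ½ * ½ * (r * r - (ι s * ι s + ι 4 * (1ℚ + ι s) * ι M))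
    identity = solve 3 (λ σ M r → let θ = con ½ :* (σ :+ r) in
      θ :* θ :+ θ := (con 1ℚ :+ σ) :* θ :+ (con 1ℚ :+ σ) :* M :+ con ½ :* con ½ :* (r :* r :- (σ :* σ :+ con (ι 4) :* (con 1ℚ :+ σ) :* M)))
      refl (ι s) (ι M) r

  -- Replacing the root by an upper approximation within ε raises the threshold by at most ½ ε, so
  -- half of the gap ε below ρ survives.
  large-from-√ : ∀ s M ρ → fromℚ ½ *ℝ (fromℕ s +ℝ √ (s ℕ.* s ℕ.+ 4 ℕ.* suc s ℕ.* M)) <ℝ ρ → SpectrallyLarge (suc s) M ρ
  large-from-√ s M ρ (ε , 0<ε , K₁ , gap) = ½ * (ι s + r) ,
    above-√ s M r (/-mono-≤ 0 (suc (√-numerator m K)) 0 K z≤n) (√-upper-square m K) ,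
    ½ * ε , 0<* (ℚₚ.positive⁻¹ ½) 0<ε , K , λ k K≤k → begin
      ½ * (ι s + r) + ½ * ε
        ≤⟨ ℚₚ.+-monoˡ-≤ (½ * ε) (ℚₚ.*-monoˡ-≤-nonNeg ½ (ℚₚ.+-monoʳ-≤ (ι s)
             (proj₂ close K k (ℕₚ.m≤n⊔m K₁ K₂) (ℕₚ.≤-trans (ℕₚ.m≤n⊔m K₁ K₂) K≤k)))) ⟩
      ½ * (ι s + (√-seq m k + ε)) + ½ * ε
        ≡⟨ solve 3 (λ σ x ε → con ½ :* (σ :+ (x :+ ε)) :+ con ½ :* ε := con ½ :* (σ :+ x) :+ ε) refl (ι s) (√-seq m k) ε ⟩
      ½ * (ι s + √-seq m k) + ε
        ≤⟨ gap k (ℕₚ.≤-trans (ℕₚ.m≤m⊔n K₁ K₂) K≤k) ⟩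
      seq ρ k ∎
    where
    open ℚₚ.≤-Reasoning
    open +-*-Solver using (solve; con; _:+_; _:*_; _:=_)
    m : ℕ
    m = s ℕ.* s ℕ.+ 4 ℕ.* suc s ℕ.* M
    close = √-upper-close m ε 0<ε
    K₂ K : ℕ
    K₂ = proj₁ close
    K = K₁ ℕ.⊔ K₂
    r : ℚ
    r = √-upper m K

  -- For m = 0 the root of the quadratic is the rational 2 s itself, so it serves as θ without
  -- approximation.
  above-2s : ∀ s → AboveThreshold s (2 ℕ.* s ℕ.+ 2 ℕ.+ 0) (ι s + ι s)
  above-2s s = 0≤+ (0≤ι s) (0≤ι s) , ℚₚ.≤-reflexive (trans (cong (λ z → ι s * (ι s + ι s) + ι s * z) (2s+2+m s 0))
    (solve 1 (λ σ → σ :* (σ :+ σ) :+ σ :* (σ :+ σ :+ (con 1ℚ :+ con 1ℚ) :+ con 0ℚ) := (σ :+ σ) :* (σ :+ σ) :+ (σ :+ σ)) refl (ι s)))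
    where open +-*-Solver using (solve; con; _:+_; _:*_; _:=_)

  2n/3-2 : ∀ s → (+ (2 ℕ.* (3 ℕ.* s ℕ.+ 3))) / 3 - (+ 2) / 1 ≡ ι s + ι s
  2n/3-2 s = begin
    (+ (2 ℕ.* (3 ℕ.* s ℕ.+ 3))) / 3 - ι 2   ≡⟨ cong (_- ι 2) (/-cross-≡ (2 ℕ.* (3 ℕ.* s ℕ.+ 3)) (s ℕ.+ s ℕ.+ 2) 2 0 (regroup s)) ⟩
    ι (s ℕ.+ s ℕ.+ 2) - ι 2                 ≡⟨ cong (_- ι 2) (trans (ι-homo-+ (s ℕ.+ s) 2) (cong (_+ ι 2) (ι-homo-+ s s))) ⟩
    ι s + ι s + ι 2 - ι 2                   ≡⟨ solve 2 (λ x y → x :+ x :+ y :- y := x :+ x) refl (ι s) (ι 2) ⟩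
    ι s + ι s                               ∎
    where
    open ≡-Reasoning
    open +-*-Solver using (solve; _:+_; _:-_; _:=_)
    regroup : ∀ s → 2 ℕ.* (3 ℕ.* s ℕ.+ 3) ℕ.* 1 ≡ (s ℕ.+ s ℕ.+ 2) ℕ.* 3
    regroup = ℕ-Solver.solve-∀

-- The theorem.

open import Data.Nat.Base using (_+_; _*_; _∸_; _≤_)

n∸s∸1≡2s+2+m : ∀ s m {n} → 3 * s + 3 + m ≡ n → n ∸ s ∸ 1 ≡ 2 * s + 2 + m
n∸s∸1≡2s+2+m s m refl = trans (cong (λ z → z ∸ s ∸ 1) (regroup s m)) (trans (cong (_∸ 1) (ℕₚ.m+n∸m≡n s _)) (ℕₚ.m+n∸m≡n 1 (2 * s + 2 + m)))
  where
  regroup : ∀ s m → 3 * s + 3 + m ≡ s + (1 + (2 * s + 2 + m))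
  regroup = ℕ-Solver.solve-∀

theorem1p4 : (n s : ℕ) → 1 ≤ n → 1 ≤ s → 3 * s + 3 ≤ n →
    (H : 3-Graph n) →
    (ρ : Fin n → ℝ) → (∀ v → IsSpectralRadius (link H v) (ρ v)) →
    ((∀ v → fromℚ ½ *ℝ (fromℕ (s ∸ 1) +ℝ √ ((s ∸ 1) * (s ∸ 1) + 4 * s * (n ∸ s ∸ 1))) <ℝ ρ v) →
    HasFractionalMatchingOfSize H (fromℕ (s + 1)))
    × (n ≡ 3 * s + 3 →
    (∀ v → fromℚ ((+ (2 * n)) / 3 - (+ 2) / 1) <ℝ ρ v) →
    HasPerfectFractionalMatching H)
theorem1p4 (suc N) (suc s′) _ _ 3s+3≤n H ρ isρ = ofSizeS+1 , perfectMatching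
  where
  s : ℕ
  s = suc s′
  scaled : ∀ m → 3 * s + 3 + m ≡ suc N → (∀ v → SpectrallyLarge s (2 * s + 2 + m) (ρ v)) → ScaledMatching (edges H) (s + 1)
  -- `s + 1` computes to `suc (s′ + 1)`, the positive size that `scale` expects.
  scaled m n≡ large = scale (edges H) (s′ + 1) (integral-matching s m (sym n≡) H ρ isρ large)
  ofSizeS+1 : _
  ofSizeS+1 hyp =
    let m , n≡ = ℕₚ.m≤n⇒∃[o]m+o≡n 3s+3≤n
        y , d , packed , total = scaled m n≡ λ v →
          subst (λ M → SpectrallyLarge s M (ρ v)) (n∸s∸1≡2s+2+m s m n≡) (large-from-√ s′ (suc N ∸ s ∸ 1) (ρ v) (hyp v))
    in RealMatching.ofSize H y d packed (s + 1) total
  perfectMatching : _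
  perfectMatching n≡ hyp =
    let y , d , packed , total = scaled 0 (trans (ℕₚ.+-identityʳ (3 * s + 3)) (sym n≡)) λ v →
          _ , above-2s s , subst (λ q → fromℚ q <ℝ ρ v)
            (trans (cong (λ n → (+ (2 * n)) / 3 - (+ 2) / 1) n≡) (2n/3-2 s)) (hyp v)
    in RealMatching.perfect H y d packed (s + 1) (trans n≡ (sym (ℕₚ.*-distribˡ-+ 3 s 1))) total
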